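{- Let $\mathcal{L}$ be one of $QLP$, $QK3$, or $QCL$. Then $\mathcal{L}$ is sound and complete with respect to the class of all $\mathcal{L}$-structures: for every signature $\mathcal{S}$ and every $\Gamma\cup\{A\}\subseteq Sent(\mathcal{S})$, $\Gamma\vdash_{\mathcal{L}}A$ if and only if, for every $\mathcal{L}$-structure $\mathfrak{A}$ for $\mathcal{S}$, if $v_{\mathfrak{A}}(B)=1$ for every $B\in\Gamma$, then $v_{\mathfrak{A}}(A)=1$.
   Context: **Language of $QFDE$ and its extensions.** A signature is a pair $\mathcal{S}=\langle\mathcal{C},\mathcal{P}\rangle$, where $\mathcal{C}$ is an infinite set of individual constants and $\mathcal{P}$ is a set of predicate letters, each of finite arity, containing a binary identity predicate $\approx$. The logical symbols are $\neg$, $\land,\lor$, $\forall,\exists$, and variables $\mathcal{V}=\{v_i:i\in\mathbb{N}\}$. Terms are variables and constants (no function symbols). Formulas are defined as usual, except that void quantifiers are not allowed: $\forall xB$ and $\exists xB$ are formulas only if $x$ is free in $B$. $Form(\mathcal{S})$ and $Sent(\mathcal{S})$ are the sets of formulas and of sentences (closed formulas). $A(t/x)$ is the result of replacing every free occurrence of $x$ in $A$ by $t$. **Natural deduction system $QFDE$** (over sentences of $\mathcal{S}$; $c,c_1,c_2\in\mathcal{C}$; wherever $A(c/x)$ occurs, $A$ is a formula with no free variable other than $x$; square brackets mark discharged hypotheses): - $\land I$: from $A$, $B$ infer $A\land B$. $\land E$: from $A\land B$ infer $A$; from $A\land B$ infer $B$. - $\lor I$: from $A$ infer $A\lor B$;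 from $B$ infer $A\lor B$. $\lor E$: from $A\lor B$, a derivation of $C$ from $[A]$ and a derivation of $C$ from $[B]$, infer $C$. - $\neg\land I$: from $\neg A$ infer $\neg(A\land B)$; from $\neg B$ infer $\neg(A\land B)$. $\neg\land E$: from $\neg(A\land B)$, a derivation of $C$ from $[\neg A]$ and a derivation of $C$ from $[\neg B]$, infer $C$. - $\neg\lor I$: from $\neg A$, $\neg B$ infer $\neg(A\lor B)$. $\neg\lor E$: from $\neg(A\lor B)$ infer $\neg A$; from $\neg(A\lor B)$ infer $\neg B$. - $DN$: from $A$ infer $\neg\neg A$; from $\neg\neg A$ infer $A$. - $\forall I$: from $B\lor A(c/x)$ infer $B\lor\forall xA$, provided $c$ occurs neither in $A$ or $B$ nor in any hypothesis on which $B\lor A(c/x)$ depends. $\forall E$: from $\forall xA$ infer $A(c/x)$. - $\exists I$: from $A(c/x)$ infer $\exists xA$. $\exists E$: from $\exists xA$ and a derivation of $C$ from $[A(c/x)]$ infer $C$, provided $c$ occurs neither in $A$ or $C$ nor in any hypothesis on which $C$ depends, except $A(c/x)$. - $\neg\forall I$: from $\neg A(c/x)$ infer $\neg\forall xA$. $\neg\forall E$: from $\neg\forall xA$ and a derivation of $C$ from $[\neg A(c/x)]$ infer $C$, provided $c$ occurs neither in $A$ or $C$ nor in any hypothesis on which $C$ depends, except $\neg A(c/x)$. - $\neg\exists I$: from $\neg A(c/x)$ infer $\neg\exists xA$, provided $c$ occurs neither in $A$ nor in any hypothesis on which $\neg A(c/x)$ depends. $\neg\exists E$: from $\neg\exists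 xA$ infer $\neg A(c/x)$. - $\approx I$: infer $c\approx c$ from no premises. $\approx E$: from $c_1\approx c_2$ and $A(c_1/x)$ infer $A(c_2/x)$. **Extensions.** $PEM$: infer $A\lor\neg A$ from no premises. $EXP$: from $A$, $\neg A$ infer $B$. $QLP$ is $QFDE$ plus $PEM$; $QK3$ is $QFDE$ plus $EXP$; $QCL$ is $QFDE$ plus both. $\Gamma\vdash_{\mathcal{L}}A$ means there is a (finite, tree-shaped) derivation of $A$ in $\mathcal{L}$ all of whose undischarged hypotheses belong to $\Gamma$. **Semantics.** A $QFDE$-structure for $\mathcal{S}$ is a pair $\mathfrak{A}=\langle\mathcal{D},\mathcal{I}\rangle$ with $\mathcal{D}\neq\emptyset$ such that $\mathcal{I}(c)=c^{\mathfrak{A}}\in\mathcal{D}$ for each $c\in\mathcal{C}$; each $n$-ary $P\in\mathcal{P}$ is assigned a pair $\langle P_+^{\mathfrak{A}},P_-^{\mathfrak{A}}\rangle$ with $P_+^{\mathfrak{A}}\cup P_-^{\mathfrak{A}}\subseteq\mathcal{D}^n$; and $\approx_+^{\mathfrak{A}}=\{\langle a,a\rangle:a\in\mathcal{D}\}$. It is a $QLP$-structure iff (E1) $P_+^{\mathfrak{A}}\cup P_-^{\mathfrak{A}}=\mathcal{D}^n$ for every $n$ and every $n$-ary $P\in\mathcal{P}$ (including $\approx$); a $QK3$-structure iff (E2) $P_+^{\mathfrak{A}}\cap P_-^{\mathfrak{A}}=\emptyset$ for every $P\in\mathcal{P}$ (including $\approx$); a $QCL$-structure iff both (E1) and (E2)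 hold. The diagram signature $\mathcal{S}_{\mathfrak{A}}=\langle\mathcal{C}_{\mathfrak{A}},\mathcal{P}\rangle$ adds a new constant $\overline{a}$ for each $a\in\mathcal{D}$; $\widehat{\mathfrak{A}}$ is the $\mathcal{S}_{\mathfrak{A}}$-structure that is just like $\mathfrak{A}$ except that $\overline{a}^{\widehat{\mathfrak{A}}}=a$. The valuation induced by $\mathfrak{A}$ is the (unique) map $v_{\mathfrak{A}}:Sent(\mathcal{S}_{\mathfrak{A}})\to\{0,1\}$ such that, writing $v$ for $v_{\mathfrak A}$: - $v(P(c_1,\dots,c_n))=1$ iff $\langle c_1^{\widehat{\mathfrak{A}}},\dots,c_n^{\widehat{\mathfrak{A}}}\rangle\in P_+^{\mathfrak{A}}$, and $v(\neg P(c_1,\dots,c_n))=1$ iff $\langle c_1^{\widehat{\mathfrak{A}}},\dots,c_n^{\widehat{\mathfrak{A}}}\rangle\in P_-^{\mathfrak{A}}$, for all $c_1,\dots,c_n\in\mathcal{C}_{\mathfrak{A}}$; - $v(A\land B)=1$ iff $v(A)=1$ and $v(B)=1$; $v(A\lor B)=1$ iff $v(A)=1$ or $v(B)=1$; - $v(\neg(A\land B))=1$ iff $v(\neg A)=1$ or $v(\neg B)=1$; $v(\neg(A\lor B))=1$ iff $v(\neg A)=1$ and $v(\neg B)=1$; - $v(\neg\neg A)=1$ iff $v(A)=1$; - $v(\forall xA)=1$ iff $v(A(\overline{a}/x))=1$ for every $a\in\mathcal{D}$; $v(\exists xA)=1$ iff $v(A(\overline{a}/x))=1$ for some $a\in\mathcal{D}$;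 - $v(\neg\forall xA)=1$ iff $v(\neg A(\overline{a}/x))=1$ for some $a\in\mathcal{D}$; $v(\neg\exists xA)=1$ iff $v(\neg A(\overline{a}/x))=1$ for every $a\in\mathcal{D}$. -}

module Defs where

open import Level using (Level; suc)
open import Data.Bool.Base using (Bool; true)
open import Data.Empty using (⊥-elim)
open import Data.Empty.Polymorphic using (⊥)
open import Data.Nat.Base using (ℕ)
open import Data.Nat.Properties using (_≟_)
open import Data.Product.Base using (Σ; ∃; _×_; _,_)
open import Data.Sum.Base using (_⊎_; inj₁; inj₂; [_,_]′)
import Data.Sum.Base as Sum
open import Data.Unit.Polymorphic using (⊤)
open import Data.Vec.Base as Vec using (Vec; []; _∷_)
open import Data.Vec.Relation.Unary.Any using (Any; here; there)
open import Function.Base using (id)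
open import Function.Bundles using (_⇔_; _↣_)
open import Induction.WellFounded using (WellFounded)
open import Relation.Binary.Core using (Rel)
open import Relation.Binary.PropositionalEquality using (_≡_; _≢_; refl; sym)
open import Relation.Binary.Structures using (IsStrictTotalOrder)
open import Relation.Nullary using (¬_; yes; no)
open import Relation.Unary using (Pred; _∈_; _⊆_; _∪_; _∩_; Universal; Empty)

private variable
  ℓ : Level
  C D : Set ℓ
  P : ℕ → Set ℓ
  n : ℕ

-- Equivalent to the axiom of choice.  Without propositional and function
-- extensionality, excluded middle for all types does not evidently give it.
WellOrdering : ∀ ℓ → Set (suc ℓ)
WellOrdering ℓ = (X : Set ℓ) →
  Σ (Rel X ℓ) λ _<_ → IsStrictTotalOrder _≡_ _<_ × WellFounded _<_

record Signature (ℓ : Level) : Set (suc ℓ) where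
  field
    Const    : Set ℓ
    Letter   : ℕ → Set ℓ        -- predicate letters, by arity
    ≈        : Letter 2
    infinite : ℕ ↣ Const

open Signature public

Var : Set
Var = ℕ

data Term (C : Set ℓ) : Set ℓ where
  var : Var → Term C
  con : C → Term C

_FreeInᵗ_ : {C : Set ℓ} → Var → Term C → Set ℓ
_FreeInᵗ_ {ℓ} x (var y) = Σ (x ≡ y) λ _ → ⊤ {ℓ}
x FreeInᵗ con c = ⊥

-- Void quantifiers are excluded by an argument which is irrelevant,
-- so that it does not distinguish formulas.
data Formula (C : Set ℓ) (P : ℕ → Set ℓ) : Set ℓ

_FreeIn_ : {C : Set ℓ} {P : ℕ → Set ℓ} → Var → Formula C P → Set ℓ

infix  15 ~_ ~ˢ_
infixr 14 _∧_ _∧ˢ_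
infixr 13 _∨_ _∨ˢ_
infix  10 _FreeIn_ _FreeInᵗ_ _OccursIn_ _OccursInᵗ_ _OccursInˢ_

data Formula C P where
  atom    : P n → Vec (Term C) n → Formula C P
  ~_      : Formula C P → Formula C P
  _∧_ _∨_ : Formula C P → Formula C P → Formula C P
  all ex  : (x : Var) (A : Formula C P) → .(x FreeIn A) → Formula C P

x FreeIn atom R ts = Any (x FreeInᵗ_) ts
x FreeIn ~ A       = x FreeIn A
x FreeIn A ∧ B     = x FreeIn A ⊎ x FreeIn B
x FreeIn A ∨ B     = x FreeIn A ⊎ x FreeIn B
x FreeIn all y A _ = x ≢ y × x FreeIn A
x FreeIn ex  y A _ = x ≢ y × x FreeIn A

_OccursInᵗ_ : {C : Set ℓ} → C → Term C → Set ℓ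
c OccursInᵗ var y = ⊥
c OccursInᵗ con d = c ≡ d

_OccursIn_ : {C : Set ℓ} {P : ℕ → Set ℓ} → C → Formula C P → Set ℓ
c OccursIn atom R ts = Any (c OccursInᵗ_) ts
c OccursIn ~ A       = c OccursIn A
c OccursIn A ∧ B     = c OccursIn A ⊎ c OccursIn B
c OccursIn A ∨ B     = c OccursIn A ⊎ c OccursIn B
c OccursIn all y A _ = c OccursIn A
c OccursIn ex  y A _ = c OccursIn A

substᵗ : Var → Term C → Term C → Term C
substᵗ x t (con c) = con c
substᵗ x t (var y) with y ≟ x
... | yes _ = t
... | no  _ = var y

freeᵗ-subst : ∀ {x y} {t : Term C} {n} (ts : Vec (Term C) n) → y ≢ x →
              Any (y FreeInᵗ_) ts → Any (y FreeInᵗ_) (Vec.map (substᵗ x t) ts)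
freeᵗ-subst {x = x} (var z ∷ ts) y≢x (here (refl , _)) with z ≟ x
... | yes z≡x = ⊥-elim (y≢x z≡x)
... | no  _   = here (refl , _)
freeᵗ-subst (_ ∷ ts) y≢x (there p) = there (freeᵗ-subst ts y≢x p)

-- subst A x t is A(t/x): plain replacement, with no renaming of bound variables.
subst : Formula C P → Var → Term C → Formula C P

free-subst : ∀ {x y} {t : Term C} (A : Formula C P) → y ≢ x →
             y FreeIn A → y FreeIn subst A x t

subst (atom R ts)  x t = atom R (Vec.map (substᵗ x t) ts)
subst (~ A)        x t = ~ subst A x t
subst (A ∧ B)      x t = subst A x t ∧ subst B x t
subst (A ∨ B)      x t = subst A x t ∨ subst B x t
subst (all y A nv) x t with y ≟ x
... | yes _   = all y A nv
... | no  y≢x = all y (subst A x t) (free-subst A y≢x nv)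
subst (ex y A nv)  x t with y ≟ x
... | yes _   = ex y A nv
... | no  y≢x = ex y (subst A x t) (free-subst A y≢x nv)

free-subst (atom R ts) y≢x p = freeᵗ-subst ts y≢x p
free-subst (~ A)       y≢x p = free-subst A y≢x p
free-subst (A ∧ B)     y≢x p = Sum.map (free-subst A y≢x) (free-subst B y≢x) p
free-subst (A ∨ B)     y≢x p = Sum.map (free-subst A y≢x) (free-subst B y≢x) p
free-subst {x = x} (all z A _) y≢x (y≢z , p) with z ≟ x
... | yes _ = y≢z , p
... | no  _ = y≢z , free-subst A y≢x p
free-subst {x = x} (ex z A _) y≢x (y≢z , p) with z ≟ x
... | yes _ = y≢z , p
... | no  _ = y≢z , free-subst A y≢x p

freeᵗ-inst : ∀ {x y} {c : C} {n} (ts : Vec (Term C) n) →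
             Any (y FreeInᵗ_) (Vec.map (substᵗ x (con c)) ts) →
             y ≢ x × Any (y FreeInᵗ_) ts
freeᵗ-inst (con _ ∷ ts) (here ())
freeᵗ-inst {x = x} (var z ∷ ts) (here p) with z ≟ x
freeᵗ-inst (var z ∷ ts) (here ())         | yes _
freeᵗ-inst (var z ∷ ts) (here (refl , _)) | no z≢x = z≢x , here (refl , _)
freeᵗ-inst (_ ∷ ts) (there p) with freeᵗ-inst ts p
... | y≢x , q = y≢x , there q

free-inst : ∀ {x y} {c : C} (A : Formula C P) →
            y FreeIn subst A x (con c) → y ≢ x × y FreeIn A
free-inst (atom R ts) p = freeᵗ-inst ts p
free-inst (~ A)       p = free-inst A p
free-inst (A ∧ B) (inj₁ p) with free-inst A p
... | y≢x , q = y≢x , inj₁ q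
free-inst (A ∧ B) (inj₂ p) with free-inst B p
... | y≢x , q = y≢x , inj₂ q
free-inst (A ∨ B) (inj₁ p) with free-inst A p
... | y≢x , q = y≢x , inj₁ q
free-inst (A ∨ B) (inj₂ p) with free-inst B p
... | y≢x , q = y≢x , inj₂ q
free-inst {x = x} (all z A _) p with z ≟ x
free-inst (all z A _) (y≢z , p) | yes refl = y≢z , y≢z , p
free-inst (all z A _) (y≢z , p) | no _ with free-inst A p
... | y≢x , q = y≢x , y≢z , q
free-inst {x = x} (ex z A _) p with z ≟ x
free-inst (ex z A _) (y≢z , p) | yes refl = y≢z , y≢z , p
free-inst (ex z A _) (y≢z , p) | no _ with free-inst A p
... | y≢x , q = y≢x , y≢z , q

mapᵗ : (C → D) → Term C → Term D
mapᵗ f (var x) = var x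
mapᵗ f (con c) = con (f c)

freeᵗ-map : ∀ {C D : Set ℓ} {f : C → D} {x n} (ts : Vec (Term C) n) →
            Any (x FreeInᵗ_) ts → Any (x FreeInᵗ_) (Vec.map (mapᵗ f) ts)
freeᵗ-map (var _ ∷ ts) (here p)  = here p
freeᵗ-map (_ ∷ ts)     (there p) = there (freeᵗ-map ts p)

freeᵗ-unmap : ∀ {C D : Set ℓ} {f : C → D} {x n} (ts : Vec (Term C) n) →
              Any (x FreeInᵗ_) (Vec.map (mapᵗ f) ts) → Any (x FreeInᵗ_) ts
freeᵗ-unmap (var _ ∷ ts) (here p)  = here p
freeᵗ-unmap (con _ ∷ ts) (here ())
freeᵗ-unmap (_ ∷ ts)     (there p) = there (freeᵗ-unmap ts p)

map : {C D : Set ℓ} {P : ℕ → Set ℓ} → (C → D) → Formula C P → Formula D P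

free-map : ∀ {C D : Set ℓ} {P : ℕ → Set ℓ} {f : C → D} {x} (A : Formula C P) →
           x FreeIn A → x FreeIn map f A

map f (atom R ts)  = atom R (Vec.map (mapᵗ f) ts)
map f (~ A)        = ~ map f A
map f (A ∧ B)      = map f A ∧ map f B
map f (A ∨ B)      = map f A ∨ map f B
map f (all x A nv) = all x (map f A) (free-map A nv)
map f (ex x A nv)  = ex x (map f A) (free-map A nv)

free-map (atom R ts) p         = freeᵗ-map ts p
free-map (~ A)       p         = free-map A p
free-map (A ∧ B)     p         = Sum.map (free-map A) (free-map B) p
free-map (A ∨ B)     p         = Sum.map (free-map A) (free-map B) p
free-map (all y A _) (x≢y , p) = x≢y , free-map A p
free-map (ex y A _)  (x≢y , p) = x≢y , free-map A p

free-unmap : ∀ {C D : Set ℓ} {P : ℕ → Set ℓ} {f : C → D} {x} (A : Formula C P) →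
             x FreeIn map f A → x FreeIn A
free-unmap (atom R ts) p         = freeᵗ-unmap ts p
free-unmap (~ A)       p         = free-unmap A p
free-unmap (A ∧ B)     p         = Sum.map (free-unmap A) (free-unmap B) p
free-unmap (A ∨ B)     p         = Sum.map (free-unmap A) (free-unmap B) p
free-unmap (all y A _) (x≢y , p) = x≢y , free-unmap A p
free-unmap (ex y A _)  (x≢y , p) = x≢y , free-unmap A p

record Sentence (C : Set ℓ) (P : ℕ → Set ℓ) : Set ℓ where
  constructor sentence
  field
    formula : Formula C P
    .closed : ∀ x → ¬ x FreeIn formula

open Sentence public

-- Formulas with no free variable other than x; x itself need not be free.
record Matrix (C : Set ℓ) (P : ℕ → Set ℓ) (x : Var) : Set ℓ where
  constructor matrix
  field
    body  : Formula C P
    .only : ∀ y → y FreeIn body → y ≡ x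

open Matrix public

freeᵗ-con : ∀ {x n} (cs : Vec C n) → ¬ Any (x FreeInᵗ_) (Vec.map con cs)
freeᵗ-con (c ∷ cs) (here ())
freeᵗ-con (c ∷ cs) (there p) = freeᵗ-con cs p

atomˢ : P n → Vec C n → Sentence C P
atomˢ R cs = sentence (atom R (Vec.map con cs)) λ _ → freeᵗ-con cs

~ˢ_ : Sentence C P → Sentence C P
~ˢ sentence A p = sentence (~ A) p

_∧ˢ_ _∨ˢ_ : Sentence C P → Sentence C P → Sentence C P
sentence A p ∧ˢ sentence B q = sentence (A ∧ B) λ x → [ p x , q x ]′
sentence A p ∨ˢ sentence B q = sentence (A ∨ B) λ x → [ p x , q x ]′

module _ {x : Var} where

  allˢ exˢ : (A : Matrix C P x) → .(x FreeIn body A) → Sentence C P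
  allˢ (matrix A only) nv = sentence (all x A nv) λ { y (y≢x , p) → y≢x (only y p) }
  exˢ  (matrix A only) nv = sentence (ex x A nv) λ { y (y≢x , p) → y≢x (only y p) }

  -- A ⟨ c ⟩ is A(c/x).
  infix 16 _⟨_⟩
  _⟨_⟩ : Matrix C P x → C → Sentence C P
  matrix A only ⟨ c ⟩ = sentence (subst A x (con c))
    λ y p → let (y≢x , q) = free-inst A p in y≢x (only y q)

mapˢ : {C D : Set ℓ} {P : ℕ → Set ℓ} → (C → D) → Sentence C P → Sentence D P
mapˢ f (sentence A p) = sentence (map f A) λ x q → p x (free-unmap A q)

_OccursInˢ_ : {C : Set ℓ} {P : ℕ → Set ℓ} → C → Sentence C P → Set ℓ
c OccursInˢ A = c OccursIn formula A

Sent : Signature ℓ → Set ℓ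
Sent S = Sentence (Const S) (Letter S)

data Logic : Set where
  QLP QK3 QCL : Logic

data HasPEM : Logic → Set where
  QLP : HasPEM QLP
  QCL : HasPEM QCL

data HasEXP : Logic → Set where
  QK3 : HasEXP QK3
  QCL : HasEXP QCL

module _ (L : Logic) (S : Signature ℓ) where

  private variable
    A B E : Sent S
    x : Var
    M : Matrix (Const S) (Letter S) x

  data Derivation : Sent S → Set ℓ

  -- The hypotheses on which the conclusion depends: those left undischarged.
  Hyp : Derivation A → Pred (Sent S) ℓ

  -- The undischarged hypotheses of d once those of the form A are discharged.
  _∖_ : Derivation B → Sent S → Pred (Sent S) ℓ

  Fresh : Const S → Pred (Sent S) ℓ → Set ℓ
  Fresh c Γ = ∀ X → X ∈ Γ → ¬ c OccursInˢ X

  data Derivation where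
    hyp   : (A : Sent S) → Derivation A

    ∧I    : Derivation A → Derivation B → Derivation (A ∧ˢ B)
    ∧E₁   : Derivation (A ∧ˢ B) → Derivation A
    ∧E₂   : Derivation (A ∧ˢ B) → Derivation B

    ∨I₁   : Derivation A → Derivation (A ∨ˢ B)
    ∨I₂   : Derivation B → Derivation (A ∨ˢ B)
    ∨E    : Derivation (A ∨ˢ B) → Derivation E → Derivation E → Derivation E

    ~∧I₁  : Derivation (~ˢ A) → Derivation (~ˢ (A ∧ˢ B))
    ~∧I₂  : Derivation (~ˢ B) → Derivation (~ˢ (A ∧ˢ B))
    ~∧E   : Derivation (~ˢ (A ∧ˢ B)) → Derivation E → Derivation E → Derivation E

    ~∨I   : Derivation (~ˢ A) → Derivation (~ˢ B) → Derivation (~ˢ (A ∨ˢ B))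
    ~∨E₁  : Derivation (~ˢ (A ∨ˢ B)) → Derivation (~ˢ A)
    ~∨E₂  : Derivation (~ˢ (A ∨ˢ B)) → Derivation (~ˢ B)

    ~~I   : Derivation A → Derivation (~ˢ ~ˢ A)
    ~~E   : Derivation (~ˢ ~ˢ A) → Derivation A

    ∀I    : .{nv : x FreeIn body M} (c : Const S) (d : Derivation (B ∨ˢ M ⟨ c ⟩)) →
            ¬ c OccursIn body M → ¬ c OccursInˢ B → Fresh c (Hyp d) →
            Derivation (B ∨ˢ allˢ M nv)
    ∀E    : .{nv : x FreeIn body M} (c : Const S) →
            Derivation (allˢ M nv) → Derivation (M ⟨ c ⟩)

    ∃I    : .{nv : x FreeIn body M} (c : Const S) →
            Derivation (M ⟨ c ⟩) → Derivation (exˢ M nv)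
    ∃E    : .{nv : x FreeIn body M} (c : Const S) →
            Derivation (exˢ M nv) → (d : Derivation E) →
            ¬ c OccursIn body M → ¬ c OccursInˢ E → Fresh c (d ∖ (M ⟨ c ⟩)) →
            Derivation E

    ~∀I   : .{nv : x FreeIn body M} (c : Const S) →
            Derivation (~ˢ (M ⟨ c ⟩)) → Derivation (~ˢ allˢ M nv)
    ~∀E   : .{nv : x FreeIn body M} (c : Const S) →
            Derivation (~ˢ allˢ M nv) → (d : Derivation E) →
            ¬ c OccursIn body M → ¬ c OccursInˢ E → Fresh c (d ∖ (~ˢ (M ⟨ c ⟩))) →
            Derivation E

    ~∃I   : .{nv : x FreeIn body M} (c : Const S) (d : Derivation (~ˢ (M ⟨ c ⟩))) →
            ¬ c OccursIn body M → Fresh c (Hyp d) →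
            Derivation (~ˢ exˢ M nv)
    ~∃E   : .{nv : x FreeIn body M} (c : Const S) →
            Derivation (~ˢ exˢ M nv) → Derivation (~ˢ (M ⟨ c ⟩))

    ≈I    : (c : Const S) → Derivation (atomˢ (≈ S) (c ∷ c ∷ []))
    ≈E    : (M : Matrix (Const S) (Letter S) x) (c₁ c₂ : Const S) →
            Derivation (atomˢ (≈ S) (c₁ ∷ c₂ ∷ [])) →
            Derivation (M ⟨ c₁ ⟩) → Derivation (M ⟨ c₂ ⟩)

    PEM   : HasPEM L → (A : Sent S) → Derivation (A ∨ˢ ~ˢ A)
    EXP   : HasEXP L → Derivation A → Derivation (~ˢ A) → Derivation B

  (d ∖ A) X = X ∈ Hyp d × X ≢ A

  Hyp (hyp A)                  = _≡ A
  Hyp (∧I d e)                 = Hyp d ∪ Hyp e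
  Hyp (∧E₁ d)                  = Hyp d
  Hyp (∧E₂ d)                  = Hyp d
  Hyp (∨I₁ d)                  = Hyp d
  Hyp (∨I₂ d)                  = Hyp d
  Hyp (∨E {A} {B} d e f)       = Hyp d ∪ (e ∖ A) ∪ (f ∖ B)
  Hyp (~∧I₁ d)                 = Hyp d
  Hyp (~∧I₂ d)                 = Hyp d
  Hyp (~∧E {A} {B} d e f)      = Hyp d ∪ (e ∖ (~ˢ A)) ∪ (f ∖ (~ˢ B))
  Hyp (~∨I d e)                = Hyp d ∪ Hyp e
  Hyp (~∨E₁ d)                 = Hyp d
  Hyp (~∨E₂ d)                 = Hyp d
  Hyp (~~I d)                  = Hyp d
  Hyp (~~E d)                  = Hyp d
  Hyp (∀I c d _ _ _)           = Hyp d
  Hyp (∀E c d)                 = Hyp d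
  Hyp (∃I c d)                 = Hyp d
  Hyp (∃E {M = M} c d e _ _ _)  = Hyp d ∪ (e ∖ (M ⟨ c ⟩))
  Hyp (~∀I c d)                = Hyp d
  Hyp (~∀E {M = M} c d e _ _ _) = Hyp d ∪ (e ∖ (~ˢ (M ⟨ c ⟩)))
  Hyp (~∃I c d _ _)            = Hyp d
  Hyp (~∃E c d)                = Hyp d
  Hyp (≈I c)                   = λ _ → ⊥
  Hyp (≈E M c₁ c₂ d e)         = Hyp d ∪ Hyp e
  Hyp (PEM _ A)                = λ _ → ⊥
  Hyp (EXP _ d e)              = Hyp d ∪ Hyp e

infix 5 [_∣_]_⊢_ [_∣_]_⊨_

[_∣_]_⊢_ : (L : Logic) (S : Signature ℓ) → Pred (Sent S) ℓ → Sent S → Set ℓ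
[ L ∣ S ] Γ ⊢ A = Σ (Derivation L S A) λ d → Hyp L S d ⊆ Γ

record Structure (S : Signature ℓ) : Set (suc ℓ) where
  field
    Dom      : Set ℓ
    nonempty : Dom
    ⟦_⟧      : Const S → Dom
    pos neg  : Letter S n → Pred (Vec Dom n) ℓ
    pos-≈    : ∀ a b → pos (≈ S) (a ∷ b ∷ []) ⇔ a ≡ b

  -- The constants of the diagram signature; inj₂ a is the name of a.
  Constᴰ : Set ℓ
  Constᴰ = Const S ⊎ Dom

  Sentᴰ : Set ℓ
  Sentᴰ = Sentence Constᴰ (Letter S)

  ⟦_⟧ᴰ : Constᴰ → Dom
  ⟦_⟧ᴰ = [ ⟦_⟧ , id ]′

  ⇑ : Sent S → Sentᴰ
  ⇑ = mapˢ inj₁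

  Exhaustive Exclusive : Set ℓ
  Exhaustive = ∀ {n} (R : Letter S n) → Universal (pos R ∪ neg R)
  Exclusive  = ∀ {n} (R : Letter S n) → Empty (pos R ∩ neg R)

  record IsValuation (v : Sentᴰ → Bool) : Set ℓ where
    private
      True : Sentᴰ → Set
      True A = v A ≡ true
    field
      v-atom  : (R : Letter S n) (cs : Vec Constᴰ n) →
                True (atomˢ R cs) ⇔ Vec.map ⟦_⟧ᴰ cs ∈ pos R
      v-~atom : (R : Letter S n) (cs : Vec Constᴰ n) →
                True (~ˢ atomˢ R cs) ⇔ Vec.map ⟦_⟧ᴰ cs ∈ neg R
      v-∧     : ∀ A B → True (A ∧ˢ B) ⇔ (True A × True B)
      v-∨     : ∀ A B → True (A ∨ˢ B) ⇔ (True A ⊎ True B)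
      v-~∧    : ∀ A B → True (~ˢ (A ∧ˢ B)) ⇔ (True (~ˢ A) ⊎ True (~ˢ B))
      v-~∨    : ∀ A B → True (~ˢ (A ∨ˢ B)) ⇔ (True (~ˢ A) × True (~ˢ B))
      v-~~    : ∀ A → True (~ˢ ~ˢ A) ⇔ True A
      v-∀     : ∀ {x} (M : Matrix Constᴰ (Letter S) x) .(nv : x FreeIn body M) →
                True (allˢ M nv) ⇔ (∀ a → True (M ⟨ inj₂ a ⟩))
      v-∃     : ∀ {x} (M : Matrix Constᴰ (Letter S) x) .(nv : x FreeIn body M) →
                True (exˢ M nv) ⇔ (∃ λ a → True (M ⟨ inj₂ a ⟩))
      v-~∀    : ∀ {x} (M : Matrix Constᴰ (Letter S) x) .(nv : x FreeIn body M) →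
                True (~ˢ allˢ M nv) ⇔ (∃ λ a → True (~ˢ (M ⟨ inj₂ a ⟩)))
      v-~∃    : ∀ {x} (M : Matrix Constᴰ (Letter S) x) .(nv : x FreeIn body M) →
                True (~ˢ exˢ M nv) ⇔ (∀ a → True (~ˢ (M ⟨ inj₂ a ⟩)))

IsStructureFor : Logic → {S : Signature ℓ} → Structure S → Set ℓ
IsStructureFor QLP 𝔄 = Structure.Exhaustive 𝔄
IsStructureFor QK3 𝔄 = Structure.Exclusive 𝔄
IsStructureFor QCL 𝔄 = Structure.Exhaustive 𝔄 × Structure.Exclusive 𝔄

-- The valuation induced by 𝔄 is determined only up to pointwise equality,
-- so consequence quantifies over all maps satisfying its defining clauses.
[_∣_]_⊨_ : (L : Logic) (S : Signature ℓ) → Pred (Sent S) ℓ → Sent S → Set (suc ℓ)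
[ L ∣ S ] Γ ⊨ A =
  (𝔄 : Structure S) → IsStructureFor L 𝔄 →
  let open Structure 𝔄 in
  (v : Sentᴰ → Bool) → IsValuation v →
  (∀ B → B ∈ Γ → v (⇑ B) ≡ true) → v (⇑ A) ≡ true

{-# OPTIONS --safe #-}
module Submission where

-- Soundness: by induction on a derivation, under every assignment of constants of the diagram
-- signature to those of S at once, since eigenconstants have to be reassigned.
--
-- Completeness: adjoin a constant wit B for every formula B of the enlarged language itself, and
-- run through the sentences by rank (the depth of nesting of wit in them), breaking ties by a
-- well-order.  Each sentence B is accepted or rejected so that the accepted sentences do not prove
-- any disjunction of rejected ones and A.  An accepted ∃xM or ¬∀xM is accepted together with its
-- instance at wit B; dually, a rejected ∀xM or ¬∃xM is rejected together with its instance at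
-- wit B, which the side disjunct of ∀I permits.  As wit B occurs in nothing decided earlier, one of
-- the two choices always preserves consistency.  The accepted sentences form a theory which is
-- prime and has witnesses, and so is the set of truths of a structure, whose individuals are the
-- least constants in their classes modulo accepted identities.  Finally, a derivation in the
-- enlarged language is carried back to S by a renaming which may identify constants, the
-- eigenconstants being chosen afresh.
open import Defs
open import Axiom.ExcludedMiddle using (ExcludedMiddle)
open import Data.Bool.Base using (Bool; true; false)
import Data.Bool.Properties as Bool
open import Data.Empty using (⊥-elim; ⊥-elim-irr)
import Data.Empty as Empty
open import Data.Empty.Polymorphic using (⊥)
open import Data.List.Base as List using (List; []; _∷_; [_]; _++_; foldr)
open import Data.List.Membership.Propositional using () renaming (_∈_ to _∈ˡ_)
open import Data.List.Membership.Propositional.Properties using (∈-++⁺ˡ; ∈-++⁺ʳ; ∈-++⁻; ∈-map⁺)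
open import Data.List.Relation.Unary.Any using (here; there)
open import Data.Maybe.Base using (Maybe; just; nothing)
open import Data.Maybe.Properties using (just-injective)
open import Data.Nat.Base using (ℕ; suc; _⊔_; _≤_; _<_; s≤s)
open import Data.Nat.Induction using (<-wellFounded)
open import Data.Nat.Properties as ℕ using (_≟_)
open import Data.Product.Base using (Σ; ∃; ∃₂; _×_; _,_; proj₁; proj₂)
open import Data.Product.Function.NonDependent.Propositional using (_×-⇔_)
open import Data.Product.Relation.Binary.Lex.Strict using (×-Lex; ×-wellFounded)
open import Data.Sum.Base as Sum using (_⊎_; inj₁; inj₂; [_,_]′)
open import Data.Sum.Function.Propositional using (_⊎-⇔_)
open import Data.Unit.Polymorphic using (⊤)
open import Data.Vec.Base as Vec using (Vec; []; _∷_)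
import Data.Vec.Properties as Vec
open import Data.Vec.Relation.Unary.Any using (Any; here; there)
open import Function.Base using (id; _∘_; _on_)
open import Function.Bundles using (_⇔_; mk⇔; _↣_; mk↣; Equivalence; Injection)
import Function.Properties.Equivalence as ⇔
open import Induction.WellFounded as WF using (WellFounded; WfRec)
open import Level using (Level; Lift; lift)
open import Relation.Binary.Construct.On as On using ()
open import Relation.Binary.Core using (Rel)
open import Relation.Binary.Definitions using (Transitive; tri<; tri≈; tri>)
open import Relation.Binary.PropositionalEquality as ≡
  using (_≡_; _≢_; refl; sym; trans; cong; cong₂)
open import Relation.Binary.Structures using (IsStrictTotalOrder)
open import Relation.Nullary using (¬_; Dec; yes; no; does; contradiction; recompute)
open import Relation.Nullary.Decidable using (decidable-stable; does-⇔)
open import Relation.Unary using (Pred; _∈_; _⊆_; _∪_; _∩_)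

private variable
  ℓ : Level
  n : ℕ

-- Renaming of constants, and its interplay with substitution and occurrence.

module _ {C : Set ℓ} {P : ℕ → Set ℓ} {x : Var} where

  all-cong : {A B : Formula C P} .{nv : x FreeIn A} .{nv′ : x FreeIn B} →
             A ≡ B → all x A nv ≡ all x B nv′
  all-cong refl = refl

  ex-cong : {A B : Formula C P} .{nv : x FreeIn A} .{nv′ : x FreeIn B} →
            A ≡ B → ex x A nv ≡ ex x B nv′
  ex-cong refl = refl

sentence-≡ : {C : Set ℓ} {P : ℕ → Set ℓ} {A B : Sentence C P} →
             formula A ≡ formula B → A ≡ B
sentence-≡ refl = refl

mapᵐ : {C D : Set ℓ} {P : ℕ → Set ℓ} {x : Var} → (C → D) → Matrix C P x → Matrix D P x
mapᵐ f (matrix A only) = matrix (map f A) λ y p → only y (free-unmap A p)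

-- The instance of `~ᵐ M` at `c` is definitionally `~ˢ (M ⟨ c ⟩)`, so facts about matrices also
-- serve the rules for negated quantifiers.
~ᵐ_ : {C : Set ℓ} {P : ℕ → Set ℓ} {x : Var} → Matrix C P x → Matrix C P x
~ᵐ matrix A only = matrix (~ A) only

module _ {C D : Set ℓ} (f : C → D) where

  mapᵗ-substᵗ : ∀ x c (t : Term C) →
                mapᵗ f (substᵗ x (con c) t) ≡ substᵗ x (con (f c)) (mapᵗ f t)
  mapᵗ-substᵗ x c (con d) = refl
  mapᵗ-substᵗ x c (var y) with y ≟ x
  ... | yes _ = refl
  ... | no  _ = refl

  map-substᵗ : ∀ x c (ts : Vec (Term C) n) →
               Vec.map (mapᵗ f) (Vec.map (substᵗ x (con c)) ts) ≡
               Vec.map (substᵗ x (con (f c))) (Vec.map (mapᵗ f) ts)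
  map-substᵗ x c []       = refl
  map-substᵗ x c (t ∷ ts) = cong₂ _∷_ (mapᵗ-substᵗ x c t) (map-substᵗ x c ts)

  map-subst : ∀ {P : ℕ → Set ℓ} (A : Formula C P) x c →
              map f (subst A x (con c)) ≡ subst (map f A) x (con (f c))
  map-subst (atom R ts) x c = cong (atom R) (map-substᵗ x c ts)
  map-subst (~ A)       x c = cong ~_ (map-subst A x c)
  map-subst (A ∧ B)     x c = cong₂ _∧_ (map-subst A x c) (map-subst B x c)
  map-subst (A ∨ B)     x c = cong₂ _∨_ (map-subst A x c) (map-subst B x c)
  map-subst (all y A _) x c with y ≟ x
  ... | yes _ = refl
  ... | no  _ = all-cong (map-subst A x c)
  map-subst (ex y A _)  x c with y ≟ x
  ... | yes _ = refl
  ... | no  _ = ex-cong (map-subst A x c)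

  mapˢ-⟨⟩ : ∀ {P : ℕ → Set ℓ} {x} (M : Matrix C P x) c → mapˢ f (M ⟨ c ⟩) ≡ mapᵐ f M ⟨ f c ⟩
  mapˢ-⟨⟩ (matrix A _) c = sentence-≡ (map-subst A _ c)

  map-con : (cs : Vec C n) → Vec.map (mapᵗ f) (Vec.map con cs) ≡ Vec.map con (Vec.map f cs)
  map-con []       = refl
  map-con (c ∷ cs) = cong (con (f c) ∷_) (map-con cs)

  mapˢ-atom : ∀ {P : ℕ → Set ℓ} (R : P n) cs → mapˢ f (atomˢ {P = P} R cs) ≡ atomˢ R (Vec.map f cs)
  mapˢ-atom R cs = sentence-≡ (cong (atom R) (map-con cs))

map-congᵗ : {C D : Set ℓ} {f g : C → D} (ts : Vec (Term C) n) →
            (∀ c → Any (c OccursInᵗ_) ts → f c ≡ g c) →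
            Vec.map (mapᵗ f) ts ≡ Vec.map (mapᵗ g) ts
map-congᵗ []           eq = refl
map-congᵗ (var x ∷ ts) eq = cong (var x ∷_) (map-congᵗ ts λ c → eq c ∘ there)
map-congᵗ (con c ∷ ts) eq = cong₂ _∷_ (cong con (eq c (here refl))) (map-congᵗ ts λ c → eq c ∘ there)

map-cong : {C D : Set ℓ} {P : ℕ → Set ℓ} {f g : C → D} (A : Formula C P) →
           (∀ c → c OccursIn A → f c ≡ g c) → map f A ≡ map g A
map-cong (atom R ts) eq = cong (atom R) (map-congᵗ ts eq)
map-cong (~ A)       eq = cong ~_ (map-cong A eq)
map-cong (A ∧ B)     eq = cong₂ _∧_ (map-cong A λ c → eq c ∘ inj₁) (map-cong B λ c → eq c ∘ inj₂)
map-cong (A ∨ B)     eq = cong₂ _∨_ (map-cong A λ c → eq c ∘ inj₁) (map-cong B λ c → eq c ∘ inj₂)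
map-cong (all x A _) eq = all-cong (map-cong A eq)
map-cong (ex x A _)  eq = ex-cong (map-cong A eq)

map-∘ᵗ : {C D E : Set ℓ} {g : D → E} {f : C → D} (ts : Vec (Term C) n) →
         Vec.map (mapᵗ g) (Vec.map (mapᵗ f) ts) ≡ Vec.map (mapᵗ (g ∘ f)) ts
map-∘ᵗ []           = refl
map-∘ᵗ (var x ∷ ts) = cong (_ ∷_) (map-∘ᵗ ts)
map-∘ᵗ (con c ∷ ts) = cong (_ ∷_) (map-∘ᵗ ts)

map-∘ : {C D E : Set ℓ} {P : ℕ → Set ℓ} {g : D → E} {f : C → D} (A : Formula C P) →
        map g (map f A) ≡ map (g ∘ f) A
map-∘ (atom R ts) = cong (atom R) (map-∘ᵗ ts)
map-∘ (~ A)       = cong ~_ (map-∘ A)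
map-∘ (A ∧ B)     = cong₂ _∧_ (map-∘ A) (map-∘ B)
map-∘ (A ∨ B)     = cong₂ _∨_ (map-∘ A) (map-∘ B)
map-∘ (all x A _) = all-cong (map-∘ A)
map-∘ (ex x A _)  = ex-cong (map-∘ A)

map-idᵗ : {C : Set ℓ} (ts : Vec (Term C) n) → Vec.map (mapᵗ id) ts ≡ ts
map-idᵗ []           = refl
map-idᵗ (var x ∷ ts) = cong (_ ∷_) (map-idᵗ ts)
map-idᵗ (con c ∷ ts) = cong (_ ∷_) (map-idᵗ ts)

map-id : {C : Set ℓ} {P : ℕ → Set ℓ} (A : Formula C P) → map id A ≡ A
map-id (atom R ts) = cong (atom R) (map-idᵗ ts)
map-id (~ A)       = cong ~_ (map-id A)
map-id (A ∧ B)     = cong₂ _∧_ (map-id A) (map-id B)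
map-id (A ∨ B)     = cong₂ _∨_ (map-id A) (map-id B)
map-id (all x A _) = all-cong (map-id A)
map-id (ex x A _)  = ex-cong (map-id A)

occursᵗ-subst : ∀ {C : Set ℓ} {x} {c d : C} (ts : Vec (Term C) n) →
                Any (c OccursInᵗ_) (Vec.map (substᵗ x (con d)) ts) →
                Any (c OccursInᵗ_) ts ⊎ c ≡ d
occursᵗ-subst (con _ ∷ ts) (here p) = inj₁ (here p)
occursᵗ-subst {x = x} (var y ∷ ts) (here p) with y ≟ x
occursᵗ-subst (var y ∷ ts) (here p) | yes _ = inj₂ p
occursᵗ-subst (var y ∷ ts) (here ()) | no _
occursᵗ-subst (_ ∷ ts) (there p) = Sum.map₁ there (occursᵗ-subst ts p)

occurs-subst : ∀ {C : Set ℓ} {P : ℕ → Set ℓ} {x} {c d : C} (A : Formula C P) →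
               c OccursIn subst A x (con d) → c OccursIn A ⊎ c ≡ d
occurs-subst (atom R ts) p        = occursᵗ-subst ts p
occurs-subst (~ A)       p        = occurs-subst A p
occurs-subst (A ∧ B)     (inj₁ p) = Sum.map₁ inj₁ (occurs-subst A p)
occurs-subst (A ∧ B)     (inj₂ p) = Sum.map₁ inj₂ (occurs-subst B p)
occurs-subst (A ∨ B)     (inj₁ p) = Sum.map₁ inj₁ (occurs-subst A p)
occurs-subst (A ∨ B)     (inj₂ p) = Sum.map₁ inj₂ (occurs-subst B p)
occurs-subst {x = x} (all y A _) p with y ≟ x
... | yes _ = inj₁ p
... | no  _ = occurs-subst A p
occurs-subst {x = x} (ex y A _)  p with y ≟ x
... | yes _ = inj₁ p
... | no  _ = occurs-subst A p

occursᵗ-map : ∀ {C D : Set ℓ} {f : C → D} {d} (ts : Vec (Term C) n) →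
              Any (d OccursInᵗ_) (Vec.map (mapᵗ f) ts) → ∃ λ c → d ≡ f c × Any (c OccursInᵗ_) ts
occursᵗ-map (con c ∷ ts) (here p)  = c , p , here refl
occursᵗ-map (_ ∷ ts)     (there p) with occursᵗ-map ts p
... | c , eq , q = c , eq , there q

-- Induction on sentences.

size : {C : Set ℓ} {P : ℕ → Set ℓ} → Formula C P → ℕ
size (atom R ts) = 0
size (~ A)       = suc (size A)
size (A ∧ B)     = suc (size A ⊔ size B)
size (A ∨ B)     = suc (size A ⊔ size B)
size (all x A _) = suc (size A)
size (ex x A _)  = suc (size A)

size-subst : ∀ {C : Set ℓ} {P : ℕ → Set ℓ} (A : Formula C P) x t → size (subst A x t) ≡ size A
size-subst (atom R ts) x t = refl
size-subst (~ A)       x t = cong suc (size-subst A x t)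
size-subst (A ∧ B)     x t = cong₂ (λ m n → suc (m ⊔ n)) (size-subst A x t) (size-subst B x t)
size-subst (A ∨ B)     x t = cong₂ (λ m n → suc (m ⊔ n)) (size-subst A x t) (size-subst B x t)
size-subst (all y A _) x t with y ≟ x
... | yes _ = refl
... | no  _ = cong suc (size-subst A x t)
size-subst (ex y A _)  x t with y ≟ x
... | yes _ = refl
... | no  _ = cong suc (size-subst A x t)

-- Closedness is irrelevant and can only be used to refute; deciding `y ≟ x` first leaves just a
-- contradiction to be drawn from it.
only-bound : {C : Set ℓ} {P : ℕ → Set ℓ} {x : Var} (A : Formula C P) →
             .(∀ y → ¬ (y ≢ x × y FreeIn A)) → ∀ y → y FreeIn A → y ≡ x
only-bound {x = x} A cl y p with y ≟ x
... | yes y≡x = y≡x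
... | no  y≢x = ⊥-elim-irr (cl y (y≢x , p))

constants : {C : Set ℓ} (ts : Vec (Term C) n) → .(∀ x → ¬ Any (x FreeInᵗ_) ts) →
            ∃ λ cs → ts ≡ Vec.map con cs
constants []           cl = [] , refl
constants (var x ∷ ts) cl = ⊥-elim-irr (cl x (here (refl , _)))
constants (con c ∷ ts) cl with constants ts (λ x → cl x ∘ there)
... | cs , refl = c ∷ cs , refl

module _ {C : Set ℓ} {P : ℕ → Set ℓ} {q : Level} (Q : Sentence C P → Set q)
         (Q-atom : ∀ {n} (R : P n) cs → Q (atomˢ R cs))
         (Q-~ : ∀ A → Q A → Q (~ˢ A))
         (Q-∧ : ∀ A B → Q A → Q B → Q (A ∧ˢ B))
         (Q-∨ : ∀ A B → Q A → Q B → Q (A ∨ˢ B))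
         (Q-all : ∀ {x} (M : Matrix C P x) .(nv : x FreeIn body M) →
                  (∀ c → Q (M ⟨ c ⟩)) → Q (allˢ M nv))
         (Q-ex : ∀ {x} (M : Matrix C P x) .(nv : x FreeIn body M) →
                 (∀ c → Q (M ⟨ c ⟩)) → Q (exˢ M nv)) where

  private
    go : ∀ k (A : Formula C P) .(cl : ∀ x → ¬ x FreeIn A) → size A < k → Q (sentence A cl)

    instances : ∀ k {x} (M : Matrix C P x) → size (body M) < k → ∀ c → Q (M ⟨ c ⟩)
    instances k (matrix A _) lt c = go k (subst A _ (con c)) _ (≡.subst (_< k) (sym (size-subst A _ _)) lt)

    go (suc k) (atom R ts) cl _ with constants ts cl
    ... | cs , refl = Q-atom R cs
    go (suc k) (~ A) cl (s≤s lt) = Q-~ (sentence A cl) (go k A cl lt)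
    go (suc k) (A ∧ B) cl (s≤s lt) = Q-∧ (sentence A _) (sentence B _)
      (go k A (λ x → cl x ∘ inj₁) (ℕ.m⊔n<o⇒m<o (size A) _ lt))
      (go k B (λ x → cl x ∘ inj₂) (ℕ.m⊔n<o⇒n<o (size A) _ lt))
    go (suc k) (A ∨ B) cl (s≤s lt) = Q-∨ (sentence A _) (sentence B _)
      (go k A (λ x → cl x ∘ inj₁) (ℕ.m⊔n<o⇒m<o (size A) _ lt))
      (go k B (λ x → cl x ∘ inj₂) (ℕ.m⊔n<o⇒n<o (size A) _ lt))
    go (suc k) (all x A nv) cl (s≤s lt) = Q-all M nv (instances k M lt)
      where M = matrix A (only-bound A cl)
    go (suc k) (ex x A nv) cl (s≤s lt) = Q-ex M nv (instances k M lt)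
      where M = matrix A (only-bound A cl)

  -- Instances of a quantified sentence are not among its subterms, so the recursion is on a bound
  -- for `size`, which substitution preserves.
  sentence-ind : ∀ A → Q A
  sentence-ind (sentence A cl) = go _ A cl (ℕ.n<1+n _)

-- Reassigning one constant.

module Update {ℓ : Level} (em : ExcludedMiddle ℓ) {C D : Set ℓ} (f : C → D) (c : C) (d : D) where

  update : C → D
  update c′ with em {P = c′ ≡ c}
  ... | yes _ = d
  ... | no  _ = f c′

  update-≡ : update c ≡ d
  update-≡ with em {P = c ≡ c}
  ... | yes _   = refl
  ... | no  c≢c = contradiction refl c≢c

  update-≢ : ∀ {c′} → c′ ≢ c → update c′ ≡ f c′
  update-≢ {c′} c′≢c with em {P = c′ ≡ c}
  ... | yes c′≡c = contradiction c′≡c c′≢c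
  ... | no  _    = refl

  map-update : ∀ {P : ℕ → Set ℓ} (A : Formula C P) → ¬ c OccursIn A → map update A ≡ map f A
  map-update A c∉A = map-cong A λ c′ p → update-≢ λ { refl → c∉A p }

  mapˢ-update : ∀ {P : ℕ → Set ℓ} (A : Sentence C P) → ¬ c OccursInˢ A → mapˢ update A ≡ mapˢ f A
  mapˢ-update A c∉A = sentence-≡ (map-update (formula A) c∉A)

  -- As `c` is absent from `M`, `update` affects only the constant put in for the variable.
  -- Soundness and renaming both reassign eigenconstants in this form.
  mapˢ-update-⟨⟩ : ∀ {P : ℕ → Set ℓ} {x} (M : Matrix C P x) → ¬ c OccursIn body M →
                   mapˢ update (M ⟨ c ⟩) ≡ mapᵐ f M ⟨ d ⟩
  mapˢ-update-⟨⟩ M c∉M = sentence-≡ (trans (map-subst update (body M) _ c)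
    (cong₂ (λ A e → subst A _ (con e)) (map-update (body M) c∉M) update-≡))

-- Soundness.

module Valuation {ℓ : Level} (em : ExcludedMiddle ℓ) {S : Signature ℓ} (𝔄 : Structure S)
                 (v : Structure.Sentᴰ 𝔄 → Bool) (val : Structure.IsValuation 𝔄 v) where

  open Structure 𝔄
  open IsValuation val
  open Equivalence

  True : Sentᴰ → Set
  True A = v A ≡ true

  True? : ∀ A → Dec (True A)
  True? A = v A Bool.≟ true

  -- Truth values are decidable, so the right disjunct may be assumed to fail. In `∀I` that failure
  -- supplies a counterexample to work with.
  True-or : ∀ A B → (¬ True B → True A) → True (A ∨ˢ B)
  True-or A B f with True? B
  ... | yes tB = v-∨ A B .from (inj₂ tB)
  ... | no ¬tB = v-∨ A B .from (inj₁ (f ¬tB))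

  module _ {x : Var} {M : Matrix Constᴰ (Letter S) x} .{nv : x FreeIn body M} where

    ∀-counterexample : ¬ True (allˢ M nv) → ∃ λ a → ¬ True (M ⟨ inj₂ a ⟩)
    ∀-counterexample ¬t with em {P = ∃ λ a → ¬ True (M ⟨ inj₂ a ⟩)}
    ... | yes p = p
    ... | no ¬p = contradiction (v-∀ M nv .from λ a → decidable-stable (True? _) λ ¬t′ → ¬p (a , ¬t′)) ¬t

  -- Exhaustiveness lifts from the atoms because the clauses for a negated compound are dual to
  -- those for the compound; the quantifiers use classical logic over the domain.
  excludedMiddle : Exhaustive → ∀ A → True A ⊎ True (~ˢ A)
  excludedMiddle exh = sentence-ind _
    (λ R cs → Sum.map (v-atom R cs .from) (v-~atom R cs .from) (exh R _))
    (λ A → λ { (inj₁ t) → inj₂ (v-~~ A .from t) ; (inj₂ t) → inj₁ t })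
    (λ A B → λ { (inj₂ f) _ → inj₂ (v-~∧ A B .from (inj₁ f))
               ; (inj₁ _) (inj₂ f) → inj₂ (v-~∧ A B .from (inj₂ f))
               ; (inj₁ t) (inj₁ u) → inj₁ (v-∧ A B .from (t , u)) })
    (λ A B → λ { (inj₁ t) _ → inj₁ (v-∨ A B .from (inj₁ t))
               ; (inj₂ _) (inj₁ t) → inj₁ (v-∨ A B .from (inj₂ t))
               ; (inj₂ f) (inj₂ g) → inj₂ (v-~∨ A B .from (f , g)) })
    case-all
    case-ex
    where
    case-all : ∀ {x} (M : Matrix Constᴰ (Letter S) x) .(nv : x FreeIn body M) →
               (∀ c → True (M ⟨ c ⟩) ⊎ True (~ˢ (M ⟨ c ⟩))) →
               True (allˢ M nv) ⊎ True (~ˢ allˢ M nv)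
    case-all M nv IH with em {P = ∃ λ a → True (~ˢ (M ⟨ inj₂ a ⟩))}
    ... | yes p = inj₂ (v-~∀ M nv .from p)
    ... | no ¬p = inj₁ (v-∀ M nv .from λ a →
      [ id , (λ f → contradiction (a , f) ¬p) ]′ (IH (inj₂ a)))
    case-ex : ∀ {x} (M : Matrix Constᴰ (Letter S) x) .(nv : x FreeIn body M) →
              (∀ c → True (M ⟨ c ⟩) ⊎ True (~ˢ (M ⟨ c ⟩))) →
              True (exˢ M nv) ⊎ True (~ˢ exˢ M nv)
    case-ex M nv IH with em {P = ∃ λ a → True (M ⟨ inj₂ a ⟩)}
    ... | yes p = inj₁ (v-∃ M nv .from p)
    ... | no ¬p = inj₂ (v-~∃ M nv .from λ a →
      [ (λ t → contradiction (a , t) ¬p) , id ]′ (IH (inj₂ a)))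

  noncontradiction : Exclusive → ∀ A → ¬ (True A × True (~ˢ A))
  noncontradiction exc = sentence-ind _
    (λ R cs (t , f) → exc R _ (v-atom R cs .to t , v-~atom R cs .to f))
    (λ A IH (f , t) → IH (v-~~ A .to t , f))
    (λ A B IHA IHB (t , f) → let (tA , tB) = v-∧ A B .to t in
      [ (λ fA → IHA (tA , fA)) , (λ fB → IHB (tB , fB)) ]′ (v-~∧ A B .to f))
    (λ A B IHA IHB (t , f) → let (fA , fB) = v-~∨ A B .to f in
      [ (λ tA → IHA (tA , fA)) , (λ tB → IHB (tB , fB)) ]′ (v-∨ A B .to t))
    (λ M nv IH (t , f) → let (a , fa) = v-~∀ M nv .to f in
      IH (inj₂ a) (v-∀ M nv .to t a , fa))
    (λ M nv IH (t , f) → let (a , ta) = v-∃ M nv .to t in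
      IH (inj₂ a) (ta , v-~∃ M nv .to f a))

  name : Constᴰ → Constᴰ
  name c = inj₂ ⟦ c ⟧ᴰ

  private
    Invariant : Sentᴰ → Set
    Invariant A = True A ⇔ True (mapˢ name A)

  -- The induction goes through because the quantifier clauses mention instances at names of
  -- individuals only, and `name` fixes those.
  True-name : ∀ A → True A ⇔ True (mapˢ name A)
  True-name A = proj₁ (invariant A)
    where
    infixr 4 _⨾_
    _⨾_ : ∀ {a b c} {A : Set a} {B : Set b} {C : Set c} → A ⇔ B → B ⇔ C → A ⇔ C
    _⨾_ = ⇔.trans
    ≡⇒⇔ : ∀ {A B} → A ≡ B → True A ⇔ True B
    ≡⇒⇔ refl = mk⇔ id id

    names : ∀ {n} (cs : Vec Constᴰ n) → Vec.map ⟦_⟧ᴰ (Vec.map name cs) ≡ Vec.map ⟦_⟧ᴰ cs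
    names cs = ≡.sym (Vec.map-∘ ⟦_⟧ᴰ name cs)

    instances : ∀ {x} (M : Matrix Constᴰ (Letter S) x) →
                (∀ c → Invariant (M ⟨ c ⟩) × Invariant (~ˢ (M ⟨ c ⟩))) → ∀ a →
                (True (M ⟨ inj₂ a ⟩) ⇔ True (mapᵐ name M ⟨ inj₂ a ⟩)) ×
                (True (~ˢ (M ⟨ inj₂ a ⟩)) ⇔ True (~ˢ (mapᵐ name M ⟨ inj₂ a ⟩)))
    instances M IH a = (proj₁ (IH (inj₂ a)) ⨾ ≡⇒⇔ eq) , (proj₂ (IH (inj₂ a)) ⨾ ≡⇒⇔ (cong ~ˢ_ eq))
      where eq = mapˢ-⟨⟩ name M (inj₂ a)

    ∀-cong : ∀ {X : Set ℓ} {P Q : X → Set} → (∀ a → P a ⇔ Q a) → (∀ a → P a) ⇔ (∀ a → Q a)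
    ∀-cong e = mk⇔ (λ f a → e a .to (f a)) (λ f a → e a .from (f a))

    ∃-cong : ∀ {X : Set ℓ} {P Q : X → Set} → (∀ a → P a ⇔ Q a) → ∃ P ⇔ ∃ Q
    ∃-cong e = mk⇔ (λ (a , p) → a , e a .to p) (λ (a , p) → a , e a .from p)

    -- `A` and `~ˢ A` are treated together, since the clauses for a negated compound refer to the
    -- negations of its parts.
    invariant : ∀ A → Invariant A × Invariant (~ˢ A)
    invariant = sentence-ind _
      (λ R cs →
        (v-atom R cs ⨾ mk⇔ (≡.subst (pos R) (≡.sym (names cs))) (≡.subst (pos R) (names cs))
          ⨾ ⇔.sym (v-atom R _) ⨾ ≡⇒⇔ (≡.sym (mapˢ-atom name R cs))) ,
        (v-~atom R cs ⨾ mk⇔ (≡.subst (neg R) (≡.sym (names cs))) (≡.subst (neg R) (names cs))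
          ⨾ ⇔.sym (v-~atom R _) ⨾ ≡⇒⇔ (≡.sym (cong ~ˢ_ (mapˢ-atom name R cs)))))
      (λ A (i , j) → j , (v-~~ A ⨾ i ⨾ ⇔.sym (v-~~ (mapˢ name A))))
      (λ A B (i , j) (k , l) →
        (v-∧ A B ⨾ (i ×-⇔ k) ⨾ ⇔.sym (v-∧ (mapˢ name A) (mapˢ name B))) ,
        (v-~∧ A B ⨾ (j ⊎-⇔ l) ⨾ ⇔.sym (v-~∧ (mapˢ name A) (mapˢ name B))))
      (λ A B (i , j) (k , l) →
        (v-∨ A B ⨾ (i ⊎-⇔ k) ⨾ ⇔.sym (v-∨ (mapˢ name A) (mapˢ name B))) ,
        (v-~∨ A B ⨾ (j ×-⇔ l) ⨾ ⇔.sym (v-~∨ (mapˢ name A) (mapˢ name B))))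
      (λ M nv IH → let IH′ = instances M IH in
        (v-∀ M nv ⨾ ∀-cong (proj₁ ∘ IH′) ⨾ ⇔.sym (v-∀ (mapᵐ name M) (free-map (body M) nv))) ,
        (v-~∀ M nv ⨾ ∃-cong (proj₂ ∘ IH′) ⨾ ⇔.sym (v-~∀ (mapᵐ name M) (free-map (body M) nv))))
      (λ M nv IH → let IH′ = instances M IH in
        (v-∃ M nv ⨾ ∃-cong (proj₁ ∘ IH′) ⨾ ⇔.sym (v-∃ (mapᵐ name M) (free-map (body M) nv))) ,
        (v-~∃ M nv ⨾ ∀-cong (proj₂ ∘ IH′) ⨾ ⇔.sym (v-~∃ (mapᵐ name M) (free-map (body M) nv))))

  open Update

  -- Both instances become the same sentence once each constant gives way to the name of its
  -- denotation. Besides `≈E`, this lets a constant be exchanged for that name.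
  True-≈ : ∀ {x} (M : Matrix Constᴰ (Letter S) x) {c d} → ⟦ c ⟧ᴰ ≡ ⟦ d ⟧ᴰ →
           True (M ⟨ c ⟩) → True (M ⟨ d ⟩)
  True-≈ M {c} {d} eq t = True-name (M ⟨ d ⟩) .from
    (≡.subst True (trans (mapˢ-⟨⟩ name M c) (trans (cong (λ a → mapᵐ name M ⟨ inj₂ a ⟩) eq)
      (sym (mapˢ-⟨⟩ name M d)))) (True-name (M ⟨ c ⟩) .to t))

  module _ (L : Logic) (isL : IsStructureFor L 𝔄) where

    private
      exhaustive : HasPEM L → Exhaustive
      exhaustive QLP = isL
      exhaustive QCL = proj₁ isL

      exclusive : HasEXP L → Exclusive
      exclusive QK3 = isL
      exclusive QCL = proj₂ isL

      Sat : (Const S → Constᴰ) → Pred (Sent S) ℓ → Set ℓ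
      Sat f Γ = ∀ X → X ∈ Γ → True (mapˢ f X)

    sound : ∀ {A} (d : Derivation L S A) (f : Const S → Constᴰ) → Sat f (Hyp L S d) → True (mapˢ f A)

    private
      -- Undischarged hypotheses are defined by inequality with `A`, so equality with `A` is decided
      -- classically.
      discharge : ∀ {A E} (d : Derivation L S E) (f : Const S → Constᴰ) →
                  True (mapˢ f A) → Sat f (_∖_ L S d A) → True (mapˢ f E)
      discharge {A} d f t sat = sound d f satisfied
        where
        satisfied : Sat f (Hyp L S d)
        satisfied X X∈d with em {P = X ≡ A}
        ... | yes refl = t
        ... | no  X≢A  = sat X (X∈d , X≢A)

      Sat-update : ∀ {f c a Γ} → Fresh L S c Γ → Sat f Γ → Sat (update em f c a) Γ
      Sat-update fresh sat X X∈Γ = ≡.subst True (sym (mapˢ-update em _ _ _ X (fresh X X∈Γ))) (sat X X∈Γ)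

      at-witness : ∀ {x} {M : Matrix (Const S) (Letter S) x} {f c a} → ¬ c OccursIn body M →
                   mapˢ (update em f c (inj₂ a)) (M ⟨ c ⟩) ≡ mapᵐ f M ⟨ inj₂ a ⟩
      at-witness {M = M} c∉M = mapˢ-update-⟨⟩ em _ _ _ M c∉M

      elsewhere : ∀ {A f c a} → ¬ c OccursInˢ A → True (mapˢ (update em f c a) A) → True (mapˢ f A)
      elsewhere {A} c∉A = ≡.subst True (mapˢ-update em _ _ _ A c∉A)

      to-name : ∀ {x} (M : Matrix (Const S) (Letter S) x) f c →
                True (mapˢ f (M ⟨ c ⟩)) → True (mapᵐ f M ⟨ name (f c) ⟩)
      to-name M f c t = True-≈ (mapᵐ f M) refl (≡.subst True (mapˢ-⟨⟩ f M c) t)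

      from-name : ∀ {x} (M : Matrix (Const S) (Letter S) x) f c →
                  True (mapᵐ f M ⟨ name (f c) ⟩) → True (mapˢ f (M ⟨ c ⟩))
      from-name M f c t = ≡.subst True (sym (mapˢ-⟨⟩ f M c)) (True-≈ (mapᵐ f M) refl t)

    sound (hyp A) f sat = sat A refl
    sound (∧I {A = A} {B = B} d e) f sat = v-∧ (mapˢ f A) (mapˢ f B) .from
      (sound d f (λ X → sat X ∘ inj₁) , sound e f (λ X → sat X ∘ inj₂))
    sound (∧E₁ {A = A} {B = B} d) f sat = proj₁ (v-∧ (mapˢ f A) (mapˢ f B) .to (sound d f sat))
    sound (∧E₂ {A = A} {B = B} d) f sat = proj₂ (v-∧ (mapˢ f A) (mapˢ f B) .to (sound d f sat))
    sound (∨I₁ {A = A} {B = B} d) f sat = v-∨ (mapˢ f A) (mapˢ f B) .from (inj₁ (sound d f sat))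
    sound (∨I₂ {B = B} {A = A} d) f sat = v-∨ (mapˢ f A) (mapˢ f B) .from (inj₂ (sound d f sat))
    sound (∨E {A = A} {B = B} d e₁ e₂) f sat
      with v-∨ (mapˢ f A) (mapˢ f B) .to (sound d f λ X → sat X ∘ inj₁)
    ... | inj₁ t = discharge e₁ f t λ X → sat X ∘ inj₂ ∘ inj₁
    ... | inj₂ t = discharge e₂ f t λ X → sat X ∘ inj₂ ∘ inj₂
    sound (~∧I₁ {A = A} {B = B} d) f sat = v-~∧ (mapˢ f A) (mapˢ f B) .from (inj₁ (sound d f sat))
    sound (~∧I₂ {B = B} {A = A} d) f sat = v-~∧ (mapˢ f A) (mapˢ f B) .from (inj₂ (sound d f sat))
    sound (~∧E {A = A} {B = B} d e₁ e₂) f sat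
      with v-~∧ (mapˢ f A) (mapˢ f B) .to (sound d f λ X → sat X ∘ inj₁)
    ... | inj₁ t = discharge e₁ f t λ X → sat X ∘ inj₂ ∘ inj₁
    ... | inj₂ t = discharge e₂ f t λ X → sat X ∘ inj₂ ∘ inj₂
    sound (~∨I {A = A} {B = B} d e) f sat = v-~∨ (mapˢ f A) (mapˢ f B) .from
      (sound d f (λ X → sat X ∘ inj₁) , sound e f (λ X → sat X ∘ inj₂))
    sound (~∨E₁ {A = A} {B = B} d) f sat = proj₁ (v-~∨ (mapˢ f A) (mapˢ f B) .to (sound d f sat))
    sound (~∨E₂ {A = A} {B = B} d) f sat = proj₂ (v-~∨ (mapˢ f A) (mapˢ f B) .to (sound d f sat))
    sound (~~I {A = A} d) f sat = v-~~ (mapˢ f A) .from (sound d f sat)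
    sound (~~E {A = A} d) f sat = v-~~ (mapˢ f A) .to (sound d f sat)
    sound (∀I {M = M} {B = B} {nv = nv} c d c∉M c∉B fresh) f sat =
      -- If the universal sentence fails at `a`, reassigning `c` to `a` falsifies the right disjunct
      -- of the premise; the left one does not contain `c`, so it holds under `f` as well.
      True-or (mapˢ f B) (allˢ (mapᵐ f M) (free-map (body M) nv)) λ ¬all →
        let (a , ¬t) = ∀-counterexample {M = mapᵐ f M} {free-map (body M) nv} ¬all
            g        = update em f c (inj₂ a) in
        [ elsewhere {B} c∉B , (λ t → contradiction (≡.subst True (at-witness {M = M} c∉M) t) ¬t) ]′
          (v-∨ (mapˢ g B) (mapˢ g (M ⟨ c ⟩)) .to (sound d g (Sat-update fresh sat)))
    sound (∀E {M = M} {nv = nv} c d) f sat =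
      from-name M f c (v-∀ (mapᵐ f M) (free-map (body M) nv) .to (sound d f sat) ⟦ f c ⟧ᴰ)
    sound (∃I {M = M} {nv = nv} c d) f sat =
      v-∃ (mapᵐ f M) (free-map (body M) nv) .from (⟦ f c ⟧ᴰ , to-name M f c (sound d f sat))
    sound (∃E {M = M} {E = E} {nv = nv} c d e c∉M c∉E fresh) f sat =
      -- `a` witnesses the major premise under `f`; the minor premise is read with `c` reassigned to
      -- the name of `a`.
      let (a , t) = v-∃ (mapᵐ f M) (free-map (body M) nv) .to (sound d f λ X → sat X ∘ inj₁) in
      elsewhere {E} c∉E (discharge e (update em f c (inj₂ a))
        (≡.subst True (sym (at-witness {M = M} c∉M)) t)
        (Sat-update fresh λ X → sat X ∘ inj₂))
    sound (~∀I {M = M} {nv = nv} c d) f sat =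
      v-~∀ (mapᵐ f M) (free-map (body M) nv) .from (⟦ f c ⟧ᴰ , to-name (~ᵐ M) f c (sound d f sat))
    sound (~∀E {M = M} {E = E} {nv = nv} c d e c∉M c∉E fresh) f sat =
      let (a , t) = v-~∀ (mapᵐ f M) (free-map (body M) nv) .to (sound d f λ X → sat X ∘ inj₁) in
      elsewhere {E} c∉E (discharge e (update em f c (inj₂ a))
        (≡.subst True (sym (at-witness {M = ~ᵐ M} c∉M)) t)
        (Sat-update fresh λ X → sat X ∘ inj₂))
    sound (~∃I {M = M} {nv = nv} c d c∉M fresh) f sat =
      v-~∃ (mapᵐ f M) (free-map (body M) nv) .from λ a → ≡.subst True (at-witness {M = ~ᵐ M} c∉M)
        (sound d (update em f c (inj₂ a)) (Sat-update fresh sat))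
    sound (~∃E {M = M} {nv = nv} c d) f sat =
      from-name (~ᵐ M) f c (v-~∃ (mapᵐ f M) (free-map (body M) nv) .to (sound d f sat) ⟦ f c ⟧ᴰ)
    sound (≈I c) f sat = v-atom _ _ .from (pos-≈ _ _ .from refl)
    sound (≈E M c₁ c₂ d e) f sat =
      ≡.subst True (sym (mapˢ-⟨⟩ f M c₂)) (True-≈ (mapᵐ f M)
        (pos-≈ _ _ .to (v-atom _ (f c₁ ∷ f c₂ ∷ []) .to (sound d f λ X → sat X ∘ inj₁)))
        (≡.subst True (mapˢ-⟨⟩ f M c₁) (sound e f λ X → sat X ∘ inj₂)))
    sound (PEM pem A) f sat with excludedMiddle (exhaustive pem) (mapˢ f A)
    ... | inj₁ t = v-∨ (mapˢ f A) (~ˢ mapˢ f A) .from (inj₁ t)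
    ... | inj₂ t = v-∨ (mapˢ f A) (~ˢ mapˢ f A) .from (inj₂ t)
    sound (EXP {A = A} exp d e) f sat = ⊥-elim (noncontradiction (exclusive exp) (mapˢ f A)
      (sound d f (λ X → sat X ∘ inj₁) , sound e f (λ X → sat X ∘ inj₂)))

-- Derived rules relative to a set of hypotheses, and finiteness of derivations.

infixl 6 _▸_
_▸_ : {X : Set ℓ} → Pred X ℓ → X → Pred X ℓ
(Γ ▸ A) X = X ∈ Γ ⊎ X ≡ A

module Provability {ℓ : Level} (L : Logic) (S : Signature ℓ) where

  infix 5 _⊢_
  infix 4 _given_
  -- A record, unlike [ L ∣ S ] Γ ⊢ A, so that Γ and A can be inferred.
  record _⊢_ (Γ : Pred (Sent S) ℓ) (A : Sent S) : Set ℓ where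
    constructor _given_
    field
      derivation : Derivation L S A
      hypotheses : Hyp L S derivation ⊆ Γ

  open _⊢_ public

  private variable
    Γ Δ : Pred (Sent S) ℓ
    A B E : Sent S

  assumption : A ∈ Γ → Γ ⊢ A
  assumption {A = A} A∈Γ = hyp A given λ { refl → A∈Γ }

  weaken : Γ ⊆ Δ → Γ ⊢ A → Δ ⊢ A
  weaken Γ⊆Δ (d given p) = d given λ q → Γ⊆Δ (p q)

  discharge : (d : Derivation L S E) → Hyp L S d ⊆ Γ ▸ A → ∀ {X} → X ∈ _∖_ L S d A → X ∈ Γ
  discharge d p (X∈d , X≢A) with p X∈d
  ... | inj₁ X∈Γ = X∈Γ
  ... | inj₂ X≡A = contradiction X≡A X≢A

  unary : (rule : Derivation L S A → Derivation L S B) →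
          (∀ d {X} → X ∈ Hyp L S (rule d) → X ∈ Hyp L S d) → Γ ⊢ A → Γ ⊢ B
  unary rule eq (d given p) = rule d given λ q → p (eq d q)

  transport : A ≡ B → Γ ⊢ A → Γ ⊢ B
  transport refl d = d

  ∧-intro : Γ ⊢ A → Γ ⊢ B → Γ ⊢ A ∧ˢ B
  ∧-intro (d given p) (e given q) = ∧I d e given [ p , q ]′

  ~∨-intro : Γ ⊢ ~ˢ A → Γ ⊢ ~ˢ B → Γ ⊢ ~ˢ (A ∨ˢ B)
  ~∨-intro (d given p) (e given q) = ~∨I d e given [ p , q ]′

  ≈-elim : ∀ {x} (M : Matrix (Const S) (Letter S) x) {c₁ c₂} →
           Γ ⊢ atomˢ (≈ S) (c₁ ∷ c₂ ∷ []) → Γ ⊢ M ⟨ c₁ ⟩ → Γ ⊢ M ⟨ c₂ ⟩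
  ≈-elim M (d given p) (e given q) = ≈E M _ _ d e given [ p , q ]′

  explosion : HasEXP L → Γ ⊢ A → Γ ⊢ ~ˢ A → Γ ⊢ B
  explosion exp (d given p) (e given q) = EXP exp d e given [ p , q ]′

  ∨-elim : Γ ⊢ A ∨ˢ B → Γ ▸ A ⊢ E → Γ ▸ B ⊢ E → Γ ⊢ E
  ∨-elim {Γ = Γ} (d given p) (e₁ given p₁) (e₂ given p₂) =
    ∨E d e₁ e₂ given [ p , [ discharge {Γ = Γ} e₁ p₁ , discharge {Γ = Γ} e₂ p₂ ]′ ]′

  ~∧-elim : Γ ⊢ ~ˢ (A ∧ˢ B) → Γ ▸ (~ˢ A) ⊢ E → Γ ▸ (~ˢ B) ⊢ E → Γ ⊢ E
  ~∧-elim {Γ = Γ} (d given p) (e₁ given p₁) (e₂ given p₂) =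
    ~∧E d e₁ e₂ given [ p , [ discharge {Γ = Γ} e₁ p₁ , discharge {Γ = Γ} e₂ p₂ ]′ ]′

  -- With no implication to introduce and eliminate, cut is disjunction elimination on `A ∨ˢ A`,
  -- both cases being treated alike.
  cut : Γ ⊢ A → Γ ▸ A ⊢ E → Γ ⊢ E
  cut {A = A} (d given p) e = ∨-elim {A = A} {B = A} (∨I₁ {A = A} {B = A} d given p) e e

  module _ {x : Var} {M : Matrix (Const S) (Letter S) x} .{nv : x FreeIn body M} {c : Const S}
           (c∉M : ¬ c OccursIn body M) (c∉Γ : Fresh L S c Γ) where

    ∀-intro : ¬ c OccursInˢ B → Γ ⊢ B ∨ˢ M ⟨ c ⟩ → Γ ⊢ B ∨ˢ allˢ M nv
    ∀-intro {B = B} c∉B (d given p) =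
      ∀I {M = M} {B = B} {nv = nv} c d c∉M c∉B (λ X q → c∉Γ X (p q)) given p

    ~∃-intro : Γ ⊢ ~ˢ (M ⟨ c ⟩) → Γ ⊢ ~ˢ exˢ M nv
    ~∃-intro (d given p) = ~∃I {M = M} {nv = nv} c d c∉M (λ X q → c∉Γ X (p q)) given p

    ∃-elim : ¬ c OccursInˢ E → Γ ⊢ exˢ M nv → Γ ▸ (M ⟨ c ⟩) ⊢ E → Γ ⊢ E
    ∃-elim c∉E (d given p) (e given q) =
      ∃E {M = M} {nv = nv} c d e c∉M c∉E (λ X r → c∉Γ X (discharge {Γ = Γ} e q r))
        given [ p , discharge {Γ = Γ} e q ]′

    ~∀-elim : ¬ c OccursInˢ E → Γ ⊢ ~ˢ allˢ M nv → Γ ▸ (~ˢ (M ⟨ c ⟩)) ⊢ E → Γ ⊢ E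
    ~∀-elim c∉E (d given p) (e given q) =
      ~∀E {M = M} {nv = nv} c d e c∉M c∉E (λ X r → c∉Γ X (discharge {Γ = Γ} e q r))
        given [ p , discharge {Γ = Γ} e q ]′

  -- The list is only an upper bound for `Γ`, so that discharging hypotheses leaves it as it is.
  record Finite (Γ : Pred (Sent S) ℓ) : Set ℓ where
    constructor finitely
    field
      elements : List (Sent S)
      covers   : ∀ X → X ∈ Γ → X ∈ˡ elements

  private
    finite-∪ : Finite Γ → Finite Δ → Finite (Γ ∪ Δ)
    finite-∪ (finitely As p) (finitely Bs q) =
      finitely (As ++ Bs) λ X → [ ∈-++⁺ˡ ∘ p X , ∈-++⁺ʳ As ∘ q X ]′

    finite-∖ : (d : Derivation L S E) → Finite (Hyp L S d) → Finite (_∖_ L S d A)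
    finite-∖ d (finitely As p) = finitely As λ X → p X ∘ proj₁

  finite : (d : Derivation L S A) → Finite (Hyp L S d)
  finite (hyp A)             = finitely [ A ] λ X → here
  finite (∧I d e)            = finite-∪ (finite d) (finite e)
  finite (∧E₁ d)             = finite d
  finite (∧E₂ d)             = finite d
  finite (∨I₁ d)             = finite d
  finite (∨I₂ d)             = finite d
  finite (∨E d e f)          = finite-∪ (finite d)
    (finite-∪ (finite-∖ e (finite e)) (finite-∖ f (finite f)))
  finite (~∧I₁ d)            = finite d
  finite (~∧I₂ d)            = finite d
  finite (~∧E d e f)         = finite-∪ (finite d)
    (finite-∪ (finite-∖ e (finite e)) (finite-∖ f (finite f)))
  finite (~∨I d e)           = finite-∪ (finite d) (finite e)
  finite (~∨E₁ d)            = finite d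
  finite (~∨E₂ d)            = finite d
  finite (~~I d)             = finite d
  finite (~~E d)             = finite d
  finite (∀I c d _ _ _)      = finite d
  finite (∀E c d)            = finite d
  finite (∃I c d)            = finite d
  finite (∃E c d e _ _ _)    = finite-∪ (finite d) (finite-∖ e (finite e))
  finite (~∀I c d)           = finite d
  finite (~∀E c d e _ _ _)   = finite-∪ (finite d) (finite-∖ e (finite e))
  finite (~∃I c d _ _)       = finite d
  finite (~∃E c d)           = finite d
  finite (≈I c)              = finitely [] λ X ()
  finite (≈E M c₁ c₂ d e)    = finite-∪ (finite d) (finite e)
  finite (PEM _ A)           = finitely [] λ X ()
  finite (EXP _ d e)         = finite-∪ (finite d) (finite e)

-- Existence of fresh constants.

module FreshConstants {ℓ : Level} (em : ExcludedMiddle ℓ) (S : Signature ℓ) where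

  open Injection (infinite S)

  -- `Q` misses a tail of the injective sequence `to`. This passes to subsets and to finite unions,
  -- although `to` may fail to exhaust the constants.
  record Avoidable (Q : Pred (Const S) ℓ) : Set ℓ where
    constructor beyond
    field
      bound  : ℕ
      avoids : ∀ n → bound ≤ n → ¬ Q (to n)

  private variable
    Q R : Pred (Const S) ℓ

  avoid-∪ : Avoidable Q → Avoidable R → Avoidable (Q ∪ R)
  avoid-∪ (beyond N p) (beyond N′ q) = beyond (N ⊔ N′)
    λ n le → [ p n (ℕ.m⊔n≤o⇒m≤o N N′ le) , q n (ℕ.m⊔n≤o⇒n≤o N N′ le) ]′

  avoid-⊆ : (∀ c → Q c → R c) → Avoidable R → Avoidable Q
  avoid-⊆ Q⊆R (beyond N p) = beyond N λ n le q → p n le (Q⊆R _ q)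

  -- By injectivity `d` has at most one index, and excluded middle tells whether it has one.
  avoid-≡ : ∀ d → Avoidable (_≡ d)
  avoid-≡ d with em {P = ∃ λ m → to m ≡ d}
  ... | yes (m , eq) = beyond (suc m) λ n m<n eq′ → ℕ.<⇒≢ m<n (injective (trans eq (sym eq′)))
  ... | no ¬p        = beyond 0 λ n _ eq → ¬p (n , eq)

  avoid-occursᵗ : (ts : Vec (Term (Const S)) n) → Avoidable (λ c → Any (c OccursInᵗ_) ts)
  avoid-occursᵗ []           = beyond 0 λ _ _ ()
  avoid-occursᵗ (var x ∷ ts) = avoid-⊆ (λ c → λ { (there p) → p }) (avoid-occursᵗ ts)
  avoid-occursᵗ (con c ∷ ts) = avoid-⊆ (λ c → λ { (here p) → inj₁ p ; (there p) → inj₂ p })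
                                       (avoid-∪ (avoid-≡ c) (avoid-occursᵗ ts))

  avoid-occurs : (A : Formula (Const S) (Letter S)) → Avoidable (_OccursIn A)
  avoid-occurs (atom R ts) = avoid-occursᵗ ts
  avoid-occurs (~ A)       = avoid-occurs A
  avoid-occurs (A ∧ B)     = avoid-∪ (avoid-occurs A) (avoid-occurs B)
  avoid-occurs (A ∨ B)     = avoid-∪ (avoid-occurs A) (avoid-occurs B)
  avoid-occurs (all x A _) = avoid-occurs A
  avoid-occurs (ex x A _)  = avoid-occurs A

  fresh-constant : (As : List (Formula (Const S) (Letter S))) →
                   ∃ λ c → ∀ A → A ∈ˡ As → ¬ c OccursIn A
  fresh-constant As with avoid As
    where
    avoid : ∀ As → Avoidable (λ c → ∃ λ A → A ∈ˡ As × c OccursIn A)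
    avoid []       = beyond 0 λ { _ _ (_ , () , _) }
    avoid (A ∷ As) = avoid-⊆
      (λ c → λ { (_ , here refl , p) → inj₁ p ; (B , there q , p) → inj₂ (B , q , p) })
      (avoid-∪ (avoid-occurs A) (avoid As))
  ... | beyond N p = to N , λ A A∈As c∈A → p N ℕ.≤-refl (A , A∈As , c∈A)

-- Renaming the constants of a derivation.

withConst : (S : Signature ℓ) {C : Set ℓ} → ℕ ↣ C → Signature ℓ
withConst S {C} inf = record { Const = C ; Letter = Letter S ; ≈ = ≈ S ; infinite = inf }

module Renaming {ℓ : Level} (em : ExcludedMiddle ℓ) (L : Logic) (S : Signature ℓ)
                {C : Set ℓ} (inf : ℕ ↣ C) where

  open Provability L S
  open FreshConstants em S
  open Update

  private
    S′ = withConst S inf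
    Hyp′ : ∀ {A} → Derivation L S′ A → Pred (Sent S′) ℓ
    Hyp′ = Hyp L S′
    infix 6 _∖′_
    _∖′_ : ∀ {A} → Derivation L S′ A → Sent S′ → Pred (Sent S′) ℓ
    _∖′_ = _∖_ L S′

  image : (C → Const S) → Pred (Sent S′) ℓ → Pred (Sent S) ℓ
  image f Γ Y = ∃ λ X → X ∈ Γ × Y ≡ mapˢ f X

  private variable
    A B E : Sent S′
    Γ Δ : Pred (Sent S′) ℓ
    f : C → Const S

  private
    image-⊆ : Γ ⊆ Δ → image f Γ ⊆ image f Δ
    image-⊆ Γ⊆Δ (X , X∈Γ , eq) = X , Γ⊆Δ X∈Γ , eq

    -- The case split is on the sentence before renaming, as `f` may send other hypotheses to the
    -- image of `A`.
    image-∖ : (d : Derivation L S′ E) → image f (Hyp′ d) ⊆ image f (d ∖′ A) ▸ mapˢ f A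
    image-∖ {A = A} d (X , X∈d , eq) with em {P = X ≡ A}
    ... | yes refl = inj₂ eq
    ... | no  X≢A  = inj₁ (X , (X∈d , X≢A) , eq)

    image-update : ∀ {c c′} → Fresh L S′ c Γ → image (update em f c c′) Γ ⊆ image f Γ
    image-update fresh (X , X∈Γ , refl) = X , X∈Γ , mapˢ-update em _ _ _ X (fresh X X∈Γ)

    -- The image under `f` of an eigenconstant may occur elsewhere, so a replacement is chosen
    -- outside the finitely many formulas concerned.
    eigenconstant : (d : Derivation L S′ E) (f : C → Const S) (A B : Formula C (Letter S)) →
      ∃ λ c → Fresh L S c (image f (Hyp′ d)) × ¬ c OccursIn map f A × ¬ c OccursIn map f B
    eigenconstant d f A B with finite′ d
      where open Provability L S′ renaming (finite to finite′)
    ... | finitely As d⊆As with fresh-constant (map f A ∷ map f B ∷ List.map (map f ∘ formula) As)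
    ... | c , fresh = c
      , (λ { Y (X , X∈d , refl) → fresh _ (there (there (∈-map⁺ (map f ∘ formula) (d⊆As X X∈d)))) })
      , fresh _ (here refl) , fresh _ (there (here refl))

  -- At a rule with eigenconstant `c` the premise is renamed by `update em f c c′`. Freshness of `c`
  -- makes this agree with `f` on the remaining hypotheses and on the conclusion; freshness of `c′`
  -- restores the proviso.
  rename : (d : Derivation L S′ A) (f : C → Const S) → image f (Hyp′ d) ⊢ mapˢ f A

  private
    rename₁ : (d : Derivation L S′ A) (f : C → Const S) → Hyp′ d ⊆ Γ → image f Γ ⊢ mapˢ f A
    rename₁ d f p = weaken (image-⊆ p) (rename d f)

    rename-∖ : (e : Derivation L S′ E) (f : C → Const S) → e ∖′ A ⊆ Γ →
               image f Γ ▸ mapˢ f A ⊢ mapˢ f E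
    rename-∖ e f p = weaken (λ q → Sum.map₁ (image-⊆ p) (image-∖ e q)) (rename e f)

    rename-∖-update : (e : Derivation L S′ E) (f : C → Const S) {c : C} {c′ : Const S} {A′ : Sent S} →
      mapˢ (update em f c c′) A ≡ A′ → ¬ c OccursInˢ E → Fresh L S′ c (e ∖′ A) → e ∖′ A ⊆ Γ →
      image f Γ ▸ A′ ⊢ mapˢ f E
    rename-∖-update {E = E} e f {c} {c′} eq c∉E fresh p = transport (mapˢ-update em f c c′ E c∉E)
      (weaken (Sum.map (image-⊆ p ∘ image-update fresh) (λ eq′ → trans eq′ eq) ∘ image-∖ e)
        (rename e (update em f c c′)))

  rename (hyp A) f = assumption (A , refl , refl)
  rename (∧I {A = A} {B = B} d e) f =
    ∧-intro {A = mapˢ f A} {B = mapˢ f B} (rename₁ d f inj₁) (rename₁ e f inj₂)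
  rename (∧E₁ {B = B} d) f = unary (∧E₁ {B = mapˢ f B}) (λ _ p → p) (rename d f)
  rename (∧E₂ {A = A} d) f = unary (∧E₂ {A = mapˢ f A}) (λ _ p → p) (rename d f)
  rename (∨I₁ {B = B} d) f = unary (∨I₁ {B = mapˢ f B}) (λ _ p → p) (rename d f)
  rename (∨I₂ {A = A} d) f = unary (∨I₂ {A = mapˢ f A}) (λ _ p → p) (rename d f)
  rename (∨E {A = A} {B = B} d e₁ e₂) f =
    ∨-elim {A = mapˢ f A} {B = mapˢ f B} (rename₁ d f inj₁)
      (rename-∖ e₁ f (inj₂ ∘ inj₁)) (rename-∖ e₂ f (inj₂ ∘ inj₂))
  rename (~∧I₁ {A = A} {B = B} d) f = unary (~∧I₁ {A = mapˢ f A} {B = mapˢ f B}) (λ _ p → p) (rename d f)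
  rename (~∧I₂ {B = B} {A = A} d) f = unary (~∧I₂ {B = mapˢ f B} {A = mapˢ f A}) (λ _ p → p) (rename d f)
  rename (~∧E {A = A} {B = B} d e₁ e₂) f =
    ~∧-elim {A = mapˢ f A} {B = mapˢ f B} (rename₁ d f inj₁)
      (rename-∖ e₁ f (inj₂ ∘ inj₁)) (rename-∖ e₂ f (inj₂ ∘ inj₂))
  rename (~∨I {A = A} {B = B} d e) f =
    ~∨-intro {A = mapˢ f A} {B = mapˢ f B} (rename₁ d f inj₁) (rename₁ e f inj₂)
  rename (~∨E₁ {A = A} {B = B} d) f = unary (~∨E₁ {A = mapˢ f A} {B = mapˢ f B}) (λ _ p → p) (rename d f)
  rename (~∨E₂ {A = A} {B = B} d) f = unary (~∨E₂ {A = mapˢ f A} {B = mapˢ f B}) (λ _ p → p) (rename d f)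
  rename (~~I {A = A} d) f = unary (~~I {A = mapˢ f A}) (λ _ p → p) (rename d f)
  rename (~~E {A = A} d) f = unary (~~E {A = mapˢ f A}) (λ _ p → p) (rename d f)
  rename (∀I {M = M} {B = B} {nv = nv} c d c∉M c∉B fresh) f
    with eigenconstant d f (body M) (formula B)
  ... | c′ , c′∉d , c′∉M , c′∉B = ∀-intro {M = mapᵐ f M} c′∉M c′∉d {B = mapˢ f B} c′∉B
    (transport (cong₂ _∨ˢ_ (mapˢ-update em f c c′ B c∉B) (mapˢ-update-⟨⟩ em f c c′ M c∉M))
      (weaken (image-update fresh) (rename d (update em f c c′))))
  rename (∀E {M = M} {nv = nv} c d) f =
    transport (sym (mapˢ-⟨⟩ f M c))
      (unary (∀E {M = mapᵐ f M} {nv = free-map (body M) nv} (f c)) (λ _ p → p) (rename d f))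
  rename (∃I {M = M} {nv = nv} c d) f =
    unary (∃I {M = mapᵐ f M} (f c)) (λ _ p → p) (transport (mapˢ-⟨⟩ f M c) (rename d f))
  rename (∃E {M = M} {E = E} {nv = nv} c d e c∉M c∉E fresh) f
    -- `∃-elim` has one context for both premises, so `c′` must avoid the hypotheses of the whole
    -- derivation, those of the major premise included.
    with eigenconstant (∃E {M = M} {E = E} {nv = nv} c d e c∉M c∉E fresh) f (body M) (formula E)
  ... | c′ , c′∉d , c′∉M , c′∉E =
    ∃-elim {M = mapᵐ f M} {nv = free-map (body M) nv} c′∉M c′∉d {E = mapˢ f E} c′∉E
      (rename₁ d f inj₁) (rename-∖-update e f (mapˢ-update-⟨⟩ em f c c′ M c∉M) c∉E fresh inj₂)
  rename (~∀I {M = M} {nv = nv} c d) f =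
    unary (~∀I {M = mapᵐ f M} (f c)) (λ _ p → p) (transport (mapˢ-⟨⟩ f (~ᵐ M) c) (rename d f))
  rename (~∀E {M = M} {E = E} {nv = nv} c d e c∉M c∉E fresh) f
    with eigenconstant (~∀E {M = M} {E = E} {nv = nv} c d e c∉M c∉E fresh) f (body M) (formula E)
  ... | c′ , c′∉d , c′∉M , c′∉E =
    ~∀-elim {M = mapᵐ f M} {nv = free-map (body M) nv} c′∉M c′∉d {E = mapˢ f E} c′∉E
      (rename₁ d f inj₁) (rename-∖-update e f (mapˢ-update-⟨⟩ em f c c′ (~ᵐ M) c∉M) c∉E fresh inj₂)
  rename (~∃I {M = M} {nv = nv} c d c∉M fresh) f
    with eigenconstant d f (body M) (body M)
  ... | c′ , c′∉d , c′∉M , _ = ~∃-intro {M = mapᵐ f M} c′∉M c′∉d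
    (transport (mapˢ-update-⟨⟩ em f c c′ (~ᵐ M) c∉M)
      (weaken (image-update fresh) (rename d (update em f c c′))))
  rename (~∃E {M = M} {nv = nv} c d) f =
    transport (sym (mapˢ-⟨⟩ f (~ᵐ M) c))
      (unary (~∃E {M = mapᵐ f M} {nv = free-map (body M) nv} (f c)) (λ _ p → p) (rename d f))
  rename (≈I c) f = ≈I (f c) given λ ()
  rename (≈E M c₁ c₂ d e) f =
    transport (sym (mapˢ-⟨⟩ f M c₂)) (≈-elim (mapᵐ f M) (rename₁ d f inj₁)
      (transport (mapˢ-⟨⟩ f M c₁) (rename₁ e f inj₂)))
  rename (PEM pem A) f = PEM pem (mapˢ f A) given λ ()
  rename (EXP {A = A} exp d e) f = explosion {A = mapˢ f A} exp (rename₁ d f inj₁) (rename₁ e f inj₂)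

-- A transfinite Lindenbaum construction, independent of the logic.

-- The elements of X are decided in the order ≺: x goes to the left (true) or to the right (false)
-- of ⊩, with the elements of added true x or added false x respectively.  Available x consists of
-- the elements which may have been placed before x is decided.
record StagedConsequence (X : Set ℓ) : Set (Level.suc ℓ) where
  infix 4 _⊩_ _≺_
  field
    _⊩_      : Pred X ℓ → Pred X ℓ → Set ℓ
    ⊩-mono   : ∀ {U U′ V V′} → U ⊆ U′ → V ⊆ V′ → U ⊩ V → U′ ⊩ V′
    ⊩-finite : ∀ {U V} → U ⊩ V → ∃₂ λ us vs → (U ∩ (_∈ˡ us)) ⊩ (V ∩ (_∈ˡ vs))

    _≺_           : Rel X ℓ
    ≺-wellFounded : WellFounded _≺_
    ≺-trans       : Transitive _≺_
    ≺-total       : ∀ x y → x ≺ y ⊎ x ≡ y ⊎ y ≺ x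

    initial    : Bool → Pred X ℓ
    consistent : ¬ initial true ⊩ initial false

    added     : Bool → X → Pred X ℓ
    Available : X → Pred X ℓ
    initial-available : ∀ b x → initial b ⊆ Available x
    added-available   : ∀ b {x y} → y ≺ x → added b y ⊆ Available x
    decide : ∀ {x U V} → U ⊆ Available x → V ⊆ Available x →
             (U ∪ added true x) ⊩ V → U ⊩ (V ∪ added false x) → U ⊩ V

module Lindenbaum {ℓ : Level} (em : ExcludedMiddle ℓ) {X : Set ℓ} (𝕊 : StagedConsequence X) where

  open StagedConsequence 𝕊

  private
    -- This is `part b (_≺ x)` with the decisions taken from the recursion hypothesis instead of
    -- from the finished `side`.
    before : ∀ b x → WfRec _≺_ (λ _ → Bool) x → Pred X ℓ
    before b x IH z = z ∈ initial b ⊎ ∃ λ y → Σ (y ≺ x) λ y≺x → IH y≺x ≡ b × z ∈ added b y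

    Acceptable : ∀ x → WfRec _≺_ (λ _ → Bool) x → Set ℓ
    Acceptable x IH = ¬ (before true x IH ∪ added true x) ⊩ before false x IH

    choose : ∀ x → WfRec _≺_ (λ _ → Bool) x → Bool
    choose x IH = does (em {Acceptable x IH})

    -- Unfolding the well-founded recursion without function extensionality asks for this: histories
    -- that agree pointwise give equivalent tests, hence the same boolean.
    choose-cong : ∀ x {IH IH′ : WfRec _≺_ (λ _ → Bool) x} →
                  (∀ {y} y≺x → IH {y} y≺x ≡ IH′ y≺x) → choose x IH ≡ choose x IH′
    choose-cong x {IH} {IH′} eq = does-⇔ (mk⇔ (acceptable (λ p → sym (eq p))) (acceptable eq)) em em
      where
      before-⊆ : ∀ {IH IH′ : WfRec _≺_ (λ _ → Bool) x} → (∀ {y} y≺x → IH {y} y≺x ≡ IH′ y≺x) →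
                 ∀ b → before b x IH ⊆ before b x IH′
      before-⊆ eq b = Sum.map₂ λ (y , y≺x , eq′ , p) → y , y≺x , trans (sym (eq y≺x)) eq′ , p
      acceptable : ∀ {IH IH′ : WfRec _≺_ (λ _ → Bool) x} → (∀ {y} y≺x → IH {y} y≺x ≡ IH′ y≺x) →
                   Acceptable x IH′ → Acceptable x IH
      acceptable eq ok bad = ok (⊩-mono (Sum.map₁ (before-⊆ eq true)) (before-⊆ eq false) bad)

  abstract
    side : X → Bool
    side = WF.All.wfRec ≺-wellFounded _ (λ _ → Bool) choose

    side-unfold : ∀ x → side x ≡ choose x (λ {y} _ → side y)
    side-unfold x = WF.FixPoint.unfold-wfRec ≺-wellFounded (λ _ → Bool) choose choose-cong

  part : Bool → Pred X ℓ → Pred X ℓ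
  part b D z = z ∈ initial b ⊎ ∃ λ y → y ∈ D × side y ≡ b × z ∈ added b y

  private
    part-⊆ : ∀ b {D E} → D ⊆ E → part b D ⊆ part b E
    part-⊆ b D⊆E = Sum.map₂ λ (y , y∈D , p) → y , D⊆E y∈D , p

    Consistent : Pred X ℓ → Set ℓ
    Consistent D = ¬ part true D ⊩ part false D

    -- `nothing` is the stage before any decision; it is what remains when `D` has no elements.
    upTo : Maybe X → Pred X ℓ
    upTo nothing  _ = ⊥
    upTo (just x) y = y ≺ x ⊎ y ≡ x

    In : Pred X ℓ → Maybe X → Set ℓ
    In D nothing  = ⊤
    In D (just x) = x ∈ D

    module _ {D : Pred X ℓ} where

      Stage : Set ℓ
      Stage = ∃ (In D)

      latest : (s t : Stage) → ∃ λ (u : Stage) →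
               upTo (proj₁ s) ⊆ upTo (proj₁ u) × upTo (proj₁ t) ⊆ upTo (proj₁ u)
      latest (nothing , _) t = t , (λ ()) , id
      latest s (nothing , _) = s , id , λ ()
      latest s@(just x , _) t@(just y , _) with ≺-total x y
      ... | inj₁ x≺y         =
        t , (λ { (inj₁ z≺x) → inj₁ (≺-trans z≺x x≺y) ; (inj₂ refl) → inj₁ x≺y }) , id
      ... | inj₂ (inj₁ refl) = s , id , id
      ... | inj₂ (inj₂ y≺x)  =
        s , id , λ { (inj₁ z≺y) → inj₁ (≺-trans z≺y y≺x) ; (inj₂ refl) → inj₁ y≺x }

      stage₁ : ∀ b {z} → z ∈ part b D → ∃ λ (s : Stage) → z ∈ part b (upTo (proj₁ s))
      stage₁ b (inj₁ p)             = (nothing , _) , inj₁ p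
      stage₁ b (inj₂ (y , y∈D , p)) = (just y , y∈D) , inj₂ (y , inj₂ refl , p)

      -- Stages form a chain because the order is total, so finitely many elements have all entered
      -- by the latest of their stages.
      stage : ∀ b zs → ∃ λ (s : Stage) → part b D ∩ (_∈ˡ zs) ⊆ part b (upTo (proj₁ s))
      stage b []       = (nothing , _) , λ { (_ , ()) }
      stage b (z ∷ zs) with stage b zs | em {P = z ∈ part b D}
      ... | s , p | no z∉  =
        s , λ { (z∈ , here refl) → contradiction z∈ z∉ ; (y∈ , there q) → p (y∈ , q) }
      ... | s , p | yes z∈ with stage₁ b z∈
      ...   | t , q with latest s t
      ...     | u , s⊆u , t⊆u = u , λ { (_ , here refl) → part-⊆ b t⊆u q
                                      ; (y∈ , there r) → part-⊆ b s⊆u (p (y∈ , r)) }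

      -- The limit step: by `⊩-finite` an inconsistency uses finitely many elements on either side,
      -- hence already appears at a single stage.
      consistent-∪ : (∀ {x} → x ∈ D → Consistent (upTo (just x))) → Consistent D
      consistent-∪ earlier bad with ⊩-finite bad
      ... | us , vs , bad′ with stage true us | stage false vs
      ...   | s , p | t , q with latest s t
      ...     | (u , u∈D) , s⊆u , t⊆u =
        consistent-at u u∈D (⊩-mono (part-⊆ true s⊆u ∘ p) (part-⊆ false t⊆u ∘ q) bad′)
        where
        consistent-at : ∀ u → In D u → Consistent (upTo u)
        consistent-at nothing  _   = consistent ∘ ⊩-mono none none
          where
          none : ∀ {b} → part b (upTo nothing) ⊆ initial b
          none (inj₁ p) = p
        consistent-at (just x) x∈D = earlier x∈D

    later : ∀ b {x} → part b (upTo (just x)) ⊆ part b (_≺ x) ∪ added b x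
    later b (inj₁ p)                       = inj₁ (inj₁ p)
    later b (inj₂ (y , inj₁ y≺x , p))      = inj₁ (inj₂ (y , y≺x , p))
    later b (inj₂ (y , inj₂ refl , _ , p)) = inj₂ p

    rest : ∀ b c {x} → side x ≡ c → c ≢ b → part b (upTo (just x)) ⊆ part b (_≺ x)
    rest b c eq c≢b (inj₁ p)                         = inj₁ p
    rest b c eq c≢b (inj₂ (y , inj₁ y≺x , p))        = inj₂ (y , y≺x , p)
    rest b c eq c≢b (inj₂ (y , inj₂ refl , eq′ , _)) = contradiction (trans (sym eq) eq′) c≢b

    available : ∀ b {x} → part b (_≺ x) ⊆ Available x
    available b (inj₁ p)                 = initial-available b _ p
    available b (inj₂ (y , y≺x , _ , p)) = added-available b y≺x p

    -- If `x` was accepted, the test for acceptance is the claim. If it was rejected, acceptance was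
    -- inconsistent, and were rejection so too, `decide` would make the earlier stage inconsistent.
    consistent-step : ∀ x → Consistent (_≺ x) → Consistent (upTo (just x))
    consistent-step x earlier bad with side x in eq
    ... | true  = accepted (em {Acceptable x (λ {y} _ → side y)}) (trans (sym (side-unfold x)) eq)
      (⊩-mono (later true) (rest false true eq λ ()) bad)
      where
      accepted : ∀ {A : Set ℓ} (a? : Dec A) → does a? ≡ true → A
      accepted (yes a) _ = a
    ... | false = rejected (em {Acceptable x (λ {y} _ → side y)}) (trans (sym (side-unfold x)) eq) λ bad′ →
      earlier (decide (available true) (available false) bad′
        (⊩-mono (rest true false eq λ ()) (later false) bad))
      where
      rejected : ∀ {A : Set ℓ} (a? : Dec A) → does a? ≡ false → ¬ A
      rejected (no ¬a) _ = ¬a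

  everything : Pred X ℓ
  everything _ = ⊤

  part-consistent : ¬ part true everything ⊩ part false everything
  part-consistent = consistent-∪ λ {x} _ → upTo-consistent x
    where
    upTo-consistent : ∀ x → Consistent (upTo (just x))
    upTo-consistent = WF.All.wfRec ≺-wellFounded _ _ λ x IH → consistent-step x (consistent-∪ IH)

-- Quantified sentences and their instances.

module _ {C : Set ℓ} {P : ℕ → Set ℓ} where

  -- The sentences whose acceptance calls for a witness.
  data Existential : Sentence C P → Set ℓ where
    ex   : ∀ {x} (M : Matrix C P x) .(nv : x FreeIn body M) → Existential (exˢ M nv)
    ~all : ∀ {x} (M : Matrix C P x) .(nv : x FreeIn body M) → Existential (~ˢ allˢ M nv)

  -- The sentences whose rejection calls for a counterexample.
  data Universal : Sentence C P → Set ℓ where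
    all : ∀ {x} (M : Matrix C P x) .(nv : x FreeIn body M) → Universal (allˢ M nv)
    ~ex : ∀ {x} (M : Matrix C P x) .(nv : x FreeIn body M) → Universal (~ˢ exˢ M nv)

  existential? : ∀ A → Maybe (Existential A)
  existential? (sentence (ex x A nv) cl)      = just (ex (matrix A (only-bound A cl)) nv)
  existential? (sentence (~ (all x A nv)) cl) = just (~all (matrix A (only-bound A cl)) nv)
  existential? _                              = nothing

  universal? : ∀ A → Maybe (Universal A)
  universal? (sentence (all x A nv) cl)    = just (all (matrix A (only-bound A cl)) nv)
  universal? (sentence (~ (ex x A nv)) cl) = just (~ex (matrix A (only-bound A cl)) nv)
  universal? _                             = nothing

  instanceᵉ : ∀ {A} → Existential A → C → Sentence C P
  instanceᵉ (ex M _)   c = M ⟨ c ⟩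
  instanceᵉ (~all M _) c = ~ˢ (M ⟨ c ⟩)

  instanceᵘ : ∀ {A} → Universal A → C → Sentence C P
  instanceᵘ (all M _) c = M ⟨ c ⟩
  instanceᵘ (~ex M _) c = ~ˢ (M ⟨ c ⟩)

  occurs-instanceᵉ : ∀ {A c d} (e : Existential A) → c OccursInˢ instanceᵉ e d → c OccursInˢ A ⊎ c ≡ d
  occurs-instanceᵉ (ex M _)   = occurs-subst (body M)
  occurs-instanceᵉ (~all M _) = occurs-subst (body M)

  occurs-instanceᵘ : ∀ {A c d} (u : Universal A) → c OccursInˢ instanceᵘ u d → c OccursInˢ A ⊎ c ≡ d
  occurs-instanceᵘ (all M _) = occurs-subst (body M)
  occurs-instanceᵘ (~ex M _) = occurs-subst (body M)

-- The Henkin language, its rank and the order of decision.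

-- Nesting `Formula` inside the inductive type yields in one stroke the union of the usual chain of
-- languages, each adding witnesses for the one before.
data Henkin (C : Set ℓ) (P : ℕ → Set ℓ) : Set ℓ where
  old : C → Henkin C P
  wit : Formula (Henkin C P) P → Henkin C P

module _ {C : Set ℓ} {P : ℕ → Set ℓ} where

  rankᶜ : Henkin C P → ℕ
  rankᵗ : Vec (Term (Henkin C P)) n → ℕ
  rank  : Formula (Henkin C P) P → ℕ

  rankᶜ (old c) = 0
  rankᶜ (wit A) = rank A

  rankᵗ []           = 0
  rankᵗ (var x ∷ ts) = rankᵗ ts
  -- The `suc` puts every constant strictly below the formulas that contain it.
  rankᵗ (con c ∷ ts) = suc (rankᶜ c) ⊔ rankᵗ ts

  rank (atom R ts) = rankᵗ ts
  rank (~ A)       = rank A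
  rank (A ∧ B)     = rank A ⊔ rank B
  rank (A ∨ B)     = rank A ⊔ rank B
  rank (all x A _) = rank A
  rank (ex x A _)  = rank A

  occursᵗ-rank : ∀ {c} (ts : Vec (Term (Henkin C P)) n) → Any (c OccursInᵗ_) ts → rankᶜ c < rankᵗ ts
  occursᵗ-rank (con c ∷ ts) (here refl) = ℕ.m≤m⊔n (suc (rankᶜ c)) (rankᵗ ts)
  occursᵗ-rank (var x ∷ ts) (there p)   = occursᵗ-rank ts p
  occursᵗ-rank (con c ∷ ts) (there p)   = ℕ.m≤n⇒m≤o⊔n _ (occursᵗ-rank ts p)

  occurs-rank : ∀ {c} (A : Formula (Henkin C P) P) → c OccursIn A → rankᶜ c < rank A
  occurs-rank (atom R ts) p        = occursᵗ-rank ts p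
  occurs-rank (~ A)       p        = occurs-rank A p
  occurs-rank (A ∧ B)     (inj₁ p) = ℕ.m≤n⇒m≤n⊔o _ (occurs-rank A p)
  occurs-rank (A ∧ B)     (inj₂ p) = ℕ.m≤n⇒m≤o⊔n _ (occurs-rank B p)
  occurs-rank (A ∨ B)     (inj₁ p) = ℕ.m≤n⇒m≤n⊔o _ (occurs-rank A p)
  occurs-rank (A ∨ B)     (inj₂ p) = ℕ.m≤n⇒m≤o⊔n _ (occurs-rank B p)
  occurs-rank (all x A _) p        = occurs-rank A p
  occurs-rank (ex x A _)  p        = occurs-rank A p

  -- `wit A` has the rank of `A`, whereas every constant of `B` has rank strictly below that of `B`.
  wit-∉ : ∀ {A} B → rank B ≤ rank A → ¬ wit A OccursIn B
  wit-∉ B le p = ℕ.<-irrefl refl (ℕ.<-≤-trans (occurs-rank B p) le)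

  wit-∉-old : ∀ {A} (B : Formula C P) → ¬ wit A OccursIn map old B
  wit-∉-old (atom R ts) p with occursᵗ-map {f = old {P = P}} ts p
  ... | _ , () , _
  wit-∉-old (~ A)       p        = wit-∉-old A p
  wit-∉-old (A ∧ B)     (inj₁ p) = wit-∉-old A p
  wit-∉-old (A ∧ B)     (inj₂ p) = wit-∉-old B p
  wit-∉-old (A ∨ B)     (inj₁ p) = wit-∉-old A p
  wit-∉-old (A ∨ B)     (inj₂ p) = wit-∉-old B p
  wit-∉-old (all x A _) p        = wit-∉-old A p
  wit-∉-old (ex x A _)  p        = wit-∉-old A p

module HenkinOrder {ℓ : Level} (wo : WellOrdering ℓ) (C : Set ℓ) (P : ℕ → Set ℓ) where

  private
    X = Sentence (Henkin C P) P
    _⊏_ : Rel X ℓ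
    _⊏_ = proj₁ (wo X)
    module ⊏ = IsStrictTotalOrder (proj₁ (proj₂ (wo X)))

  infix 4 _≺_
  _≺_ : Rel X ℓ
  _≺_ = ×-Lex _≡_ _<_ _⊏_ on λ A → rank (formula A) , A

  ≺-wellFounded : WellFounded _≺_
  ≺-wellFounded = On.wellFounded _ (×-wellFounded <-wellFounded (proj₂ (proj₂ (wo X))))

  ≺-trans : ∀ {A B D} → A ≺ B → B ≺ D → A ≺ D
  ≺-trans (inj₁ p)        (inj₁ q)        = inj₁ (ℕ.<-trans p q)
  ≺-trans (inj₁ p)        (inj₂ (eq , _)) = inj₁ (ℕ.<-≤-trans p (ℕ.≤-reflexive eq))
  ≺-trans (inj₂ (eq , _)) (inj₁ q)        = inj₁ (ℕ.≤-<-trans (ℕ.≤-reflexive eq) q)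
  ≺-trans (inj₂ (eq , p)) (inj₂ (eq′ , q)) = inj₂ (trans eq eq′ , ⊏.trans p q)

  ≺-total : ∀ A B → A ≺ B ⊎ A ≡ B ⊎ B ≺ A
  ≺-total A B with ℕ.<-cmp (rank (formula A)) (rank (formula B)) | ⊏.compare A B
  ... | tri< lt _ _ | _            = inj₁ (inj₁ lt)
  ... | tri> _ _ gt | _            = inj₂ (inj₂ (inj₁ gt))
  ... | tri≈ _ eq _ | tri< lt _ _  = inj₁ (inj₂ (eq , lt))
  ... | tri≈ _ eq _ | tri≈ _ eq′ _ = inj₂ (inj₁ eq′)
  ... | tri≈ _ eq _ | tri> _ _ gt  = inj₂ (inj₂ (inj₂ (sym eq , gt)))

  ≺-rank : ∀ {A B} → A ≺ B → rank (formula A) ≤ rank (formula B)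
  ≺-rank (inj₁ lt)       = ℕ.<⇒≤ lt
  ≺-rank (inj₂ (eq , _)) = ℕ.≤-reflexive eq

  ≺-irrefl : ∀ {A} → ¬ A ≺ A
  ≺-irrefl (inj₁ lt)       = ℕ.<-irrefl refl lt
  ≺-irrefl (inj₂ (_ , lt)) = ⊏.irrefl refl lt

henkin-infinite : {C : Set ℓ} {P : ℕ → Set ℓ} → ℕ ↣ C → ℕ ↣ Henkin C P
henkin-infinite {C = C} {P} inf = mk↣ {to = old ∘ to} (injective ∘ old-injective)
  where
  open Injection inf
  old-injective : ∀ {c d : C} → old {P = P} c ≡ old d → c ≡ d
  old-injective refl = refl

-- Consequence with several conclusions.

-- Disjunctions with a fixed last disjunct E; the language has no falsum.
module Disjunction {ℓ : Level} (L : Logic) (S : Signature ℓ) (E : Sent S) where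

  open Provability L S

  private variable
    Γ Δ : Pred (Sent S) ℓ
    A B : Sent S
    As Bs : List (Sent S)

  ⋁ : List (Sent S) → Sent S
  ⋁ = foldr _∨ˢ_ E

  ∨-intro₁ : Γ ⊢ A → Γ ⊢ A ∨ˢ B
  ∨-intro₁ {A = A} {B = B} = unary (∨I₁ {A = A} {B = B}) λ _ p → p

  ∨-intro₂ : Γ ⊢ B → Γ ⊢ A ∨ˢ B
  ∨-intro₂ {B = B} {A = A} = unary (∨I₂ {B = B} {A = A}) λ _ p → p

  ⋁-intro : A ∈ˡ As → Γ ⊢ A → Γ ⊢ ⋁ As
  ⋁-intro {As = A ∷ As} (here refl) d = ∨-intro₁ {A = A} {B = ⋁ As} d
  ⋁-intro {As = B ∷ As} (there p)   d = ∨-intro₂ {B = ⋁ As} {A = B} (⋁-intro {As = As} p d)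

  ⋁-last : ∀ As → Γ ⊢ E → Γ ⊢ ⋁ As
  ⋁-last []       d = d
  ⋁-last (A ∷ As) d = ∨-intro₂ {B = ⋁ As} {A = A} (⋁-last As d)

  new : Γ ▸ A ⊢ A
  new = assumption (inj₂ refl)

  ⋁-elim : ∀ As → Γ ⊢ ⋁ As → (∀ A → A ∈ˡ As → Γ ▸ A ⊢ B) → Γ ▸ E ⊢ B → Γ ⊢ B
  ⋁-elim []       d f g = cut d g
  ⋁-elim (A ∷ As) d f g = ∨-elim {A = A} {B = ⋁ As} d (f A (here refl))
    (⋁-elim As new (λ B p → weaken (Sum.map₁ inj₁) (f B (there p))) (weaken (Sum.map₁ inj₁) g))

  ⋁-⊆ : ∀ As Bs → (∀ A → A ∈ˡ As → A ∈ˡ Bs) → Γ ⊢ ⋁ As → Γ ⊢ ⋁ Bs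
  ⋁-⊆ As Bs As⊆Bs d = ⋁-elim As d (λ A p → ⋁-intro (As⊆Bs A p) new) (⋁-last Bs new)

  ⋁-fresh : ∀ {c} As → ¬ c OccursInˢ E → (∀ A → A ∈ˡ As → ¬ c OccursInˢ A) → ¬ c OccursInˢ ⋁ As
  ⋁-fresh []       c∉E c∉As = c∉E
  ⋁-fresh (A ∷ As) c∉E c∉As = [ c∉As A (here refl) , ⋁-fresh As c∉E (λ B → c∉As B ∘ there) ]′

  infix 4 _⊩_
  -- `E` silently counts among the conclusions: with an empty list of disjuncts, `Γ` proves `E`
  -- itself.
  record _⊩_ (Γ Δ : Pred (Sent S) ℓ) : Set ℓ where
    constructor proves
    field
      disjuncts : List (Sent S)
      ⊆Δ        : ∀ A → A ∈ˡ disjuncts → A ∈ Δ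
      proof     : Γ ⊢ ⋁ disjuncts

  ⊩-mono : ∀ {Γ Γ′ Δ Δ′} → Γ ⊆ Γ′ → Δ ⊆ Δ′ → Γ ⊩ Δ → Γ′ ⊩ Δ′
  ⊩-mono p q (proves As r d) = proves As (λ A → q ∘ r A) (weaken p d)

  ⊩-finite : Γ ⊩ Δ → ∃₂ λ As Bs → (Γ ∩ (_∈ˡ As)) ⊩ (Δ ∩ (_∈ˡ Bs))
  ⊩-finite (proves Bs r (d given p)) with finite d
  ... | finitely As q = As , Bs , proves Bs (λ B s → r B s , s) (d given λ s → p s , q _ s)

  -- Disjuncts from `Θ` are dropped from the list, to be handled case by case in an elimination of
  -- the original disjunction.
  restrict : ∀ {Δ Θ : Pred (Sent S) ℓ} As → (∀ A → A ∈ˡ As → A ∈ Δ ∪ Θ) →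
             ∃ λ Bs → (∀ A → A ∈ˡ Bs → A ∈ Δ) × (∀ A → A ∈ˡ As → A ∈ˡ Bs ⊎ A ∈ Θ)
  restrict []       p = [] , (λ _ ()) , λ _ ()
  restrict (A ∷ As) p with restrict As (λ B → p B ∘ there) | p A (here refl)
  ... | Bs , q , r | inj₁ A∈Δ = A ∷ Bs , (λ { _ (here refl) → A∈Δ ; B (there s) → q B s }) ,
    λ { _ (here refl) → inj₁ (here refl) ; B (there s) → Sum.map₁ there (r B s) }
  ... | Bs , q , r | inj₂ A∈Θ = Bs , q , λ { _ (here refl) → inj₂ A∈Θ ; B (there s) → r B s }

  -- In eliminating `⋁ Bs`, disjuncts from `Δ` are kept, while an occurrence of `A` is traded for
  -- the disjuncts `As` that it proves.
  cut-⊩ : Γ ▸ A ⊩ Δ → Γ ⊩ Δ ▸ A → Γ ⊩ Δ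
  cut-⊩ {A = A} (proves As p d) (proves Bs q e) with restrict Bs q
  ... | Ds , r , s = proves (As ++ Ds)
    (λ D → [ p D , r D ]′ ∘ ∈-++⁻ As)
    (⋁-elim Bs e (λ B t → case (s B t)) (⋁-last (As ++ Ds) new))
    where
    case : ∀ {B} → B ∈ˡ Ds ⊎ B ≡ A → _ ▸ B ⊢ ⋁ (As ++ Ds)
    case (inj₁ t)    = ⋁-intro (∈-++⁺ʳ As t) new
    case (inj₂ refl) = ⋁-⊆ As (As ++ Ds) (λ _ → ∈-++⁺ˡ) d

-- The staged consequence of the Henkin language.

module HenkinTheory {ℓ : Level} (em : ExcludedMiddle ℓ) (wo : WellOrdering ℓ)
                    (L : Logic) (S : Signature ℓ) (Γ₀ : Pred (Sent S) ℓ) (A₀ : Sent S) where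

  Const⁺ : Set ℓ
  Const⁺ = Henkin (Const S) (Letter S)

  S⁺ : Signature ℓ
  S⁺ = withConst S (henkin-infinite {P = Letter S} (infinite S))

  E : Sent S⁺
  E = mapˢ old A₀

  open Provability L S⁺
  open Disjunction L S⁺ E
  open HenkinOrder wo (Const S) (Letter S)

  witness : Sent S⁺ → Const⁺
  witness B = wit (formula B)

  -- The right side starts empty because `⊩` already carries `E`.
  initial : Bool → Pred (Sent S⁺) ℓ
  initial true  X = ∃ λ B → B ∈ Γ₀ × X ≡ mapˢ old B
  initial false X = ⊥

  added : Bool → Sent S⁺ → Pred (Sent S⁺) ℓ
  added true  B X = X ≡ B ⊎ ∃ λ e → existential? B ≡ just e × X ≡ instanceᵉ e (witness B)
  added false B X = X ≡ B ⊎ ∃ λ u → universal? B ≡ just u × X ≡ instanceᵘ u (witness B)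

  Available : Sent S⁺ → Pred (Sent S⁺) ℓ
  Available B X = ¬ witness B OccursInˢ X

  private variable
    Γ Δ : Pred (Sent S⁺) ℓ
    B : Sent S⁺

  initial-available : ∀ b B → initial b ⊆ Available B
  initial-available true B (D , _ , refl) = wit-∉-old (formula D)

  ≺-available : ∀ {B D} → D ≺ B → D ∈ Available B
  ≺-available {D = D} D≺B = wit-∉ (formula D) (≺-rank D≺B)

  wit-injective : ∀ {A B} → wit {C = Const S} {P = Letter S} A ≡ wit B → A ≡ B
  wit-injective refl = refl

  witness-≢ : ∀ {B D} → D ≺ B → witness B ≢ witness D
  witness-≢ {B} {D} D≺B eq with sentence-≡ {A = B} {B = D} (wit-injective eq)
  ... | refl = ≺-irrefl {B} D≺B

  added-available : ∀ b {B D} → D ≺ B → added b D ⊆ Available B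
  added-available true  D≺B (inj₁ refl)           = ≺-available D≺B
  added-available true  D≺B (inj₂ (e , _ , refl)) =
    [ ≺-available D≺B , witness-≢ D≺B ]′ ∘ occurs-instanceᵉ e
  added-available false D≺B (inj₁ refl)           = ≺-available D≺B
  added-available false D≺B (inj₂ (u , _ , refl)) =
    [ ≺-available D≺B , witness-≢ D≺B ]′ ∘ occurs-instanceᵘ u

  witness-∉ : ∀ B → B ∈ Available B
  witness-∉ B = wit-∉ (formula B) ℕ.≤-refl

  E-available : ∀ B → E ∈ Available B
  E-available B = wit-∉-old (formula A₀)

  -- The witness occurs neither in `B`, nor in `Γ`, nor in the disjunction proved, so it can act as
  -- the eigenconstant of an elimination that discharges the added instance.
  decideˡ : Γ ⊆ Available B → Δ ⊆ Available B → (Γ ∪ added true B) ⊩ Δ → Γ ▸ B ⊩ Δ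
  decideˡ {Γ = Γ} {B = B} Γ-avl Δ-avl (proves As p d) = proves As p (go (existential? B) refl)
    where
    fresh : Fresh L S⁺ (witness B) (Γ ▸ B)
    fresh X (inj₁ X∈Γ)  = Γ-avl X∈Γ
    fresh X (inj₂ refl) = witness-∉ B

    fresh-⋁ : ¬ witness B OccursInˢ ⋁ As
    fresh-⋁ = ⋁-fresh As (E-available B) λ D s → Δ-avl (p D s)

    extend : ∀ {e} → existential? B ≡ just e → Γ ▸ B ▸ instanceᵉ e (witness B) ⊢ ⋁ As
    extend {e} eq = weaken covered d
      where
      covered : Γ ∪ added true B ⊆ Γ ▸ B ▸ instanceᵉ e (witness B)
      covered (inj₁ q)                     = inj₁ (inj₁ q)
      covered (inj₂ (inj₁ q))              = inj₁ (inj₂ q)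
      covered (inj₂ (inj₂ (e′ , eq′ , q))) =
        inj₂ (trans q (cong (λ e → instanceᵉ e (witness B)) (just-injective (trans (sym eq′) eq))))

    go : ∀ e → existential? B ≡ e → Γ ▸ B ⊢ ⋁ As
    go nothing            eq = weaken
      (Sum.map₂ λ { (inj₁ q) → q ; (inj₂ (e , eq′ , _)) → contradiction (trans (sym eq) eq′) λ () }) d
    go (just (ex M nv))   eq = ∃-elim {M = M} {nv = nv} (witness-∉ B) fresh fresh-⋁ new (extend eq)
    go (just (~all M nv)) eq = ~∀-elim {M = M} {nv = nv} (witness-∉ B) fresh fresh-⋁ new (extend eq)

  -- All disjuncts except the instance are gathered into `⋁ (B ∷ Bs)`, which becomes the side
  -- disjunct of `∀I`; the generalized instance is then absorbed by the disjunct `B`.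
  decideʳ : Γ ⊆ Available B → Δ ⊆ Available B → Γ ⊩ (Δ ∪ added false B) → Γ ⊩ Δ ▸ B
  decideʳ {Γ = Γ} {B = B} Γ-avl Δ-avl (proves As p d) with restrict As p
  ... | Bs , q , r = proves (B ∷ Bs) (λ { _ (here eq) → inj₂ eq ; D (there s) → inj₁ (q D s) })
    (go (universal? B) refl)
    where
    fresh : Fresh L S⁺ (witness B) Γ
    fresh X = Γ-avl

    fresh-⋁ : ¬ witness B OccursInˢ ⋁ (B ∷ Bs)
    fresh-⋁ = [ witness-∉ B , ⋁-fresh Bs (E-available B) (λ D s → Δ-avl (q D s)) ]′

    collect : ∀ {u} → universal? B ≡ just u → Γ ⊢ ⋁ (B ∷ Bs) ∨ˢ instanceᵘ u (witness B)
    collect {u} eq = ⋁-elim As d (λ D → case ∘ r D)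
      (∨-intro₁ {A = ⋁ (B ∷ Bs)} {B = instanceᵘ u (witness B)} (⋁-last (B ∷ Bs) new))
      where
      case : ∀ {D} → D ∈ˡ Bs ⊎ D ∈ added false B → Γ ▸ D ⊢ ⋁ (B ∷ Bs) ∨ˢ instanceᵘ u (witness B)
      case (inj₁ s)           = ∨-intro₁ {A = ⋁ (B ∷ Bs)} {B = instanceᵘ u (witness B)}
                                         (⋁-intro {As = B ∷ Bs} (there s) new)
      case (inj₂ (inj₁ refl)) = ∨-intro₁ {A = ⋁ (B ∷ Bs)} {B = instanceᵘ u (witness B)}
                                         (⋁-intro {As = B ∷ Bs} (here refl) new)
      case (inj₂ (inj₂ (u′ , eq′ , refl))) =
        ∨-intro₂ {B = instanceᵘ u (witness B)} {A = ⋁ (B ∷ Bs)}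
          (transport (cong (λ u → instanceᵘ u (witness B)) (just-injective (trans (sym eq′) eq))) new)

    finish : ∀ {D} → Γ ⊢ ⋁ (B ∷ Bs) ∨ˢ D → Γ ▸ D ⊢ B → Γ ⊢ ⋁ (B ∷ Bs)
    finish {D} d e = ∨-elim {A = ⋁ (B ∷ Bs)} {B = D} d new (⋁-intro {As = B ∷ Bs} (here refl) e)

    go : ∀ u → universal? B ≡ u → Γ ⊢ ⋁ (B ∷ Bs)
    go nothing eq = ⋁-elim As d (λ D → case ∘ r D) (⋁-last (B ∷ Bs) new)
      where
      case : ∀ {D} → D ∈ˡ Bs ⊎ D ∈ added false B → Γ ▸ D ⊢ ⋁ (B ∷ Bs)
      case (inj₁ s)                     = ⋁-intro {As = B ∷ Bs} (there s) new
      case (inj₂ (inj₁ refl))           = ⋁-intro {As = B ∷ Bs} (here refl) new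
      case (inj₂ (inj₂ (u , eq′ , _)))  = contradiction (trans (sym eq) eq′) λ ()
    go (just (all M nv)) eq =
      finish (∀-intro {M = M} {nv = nv} (witness-∉ B) fresh {B = ⋁ (B ∷ Bs)} fresh-⋁ (collect eq)) new
    -- Since ~∃I has no side disjunct, the detour is through ∀x¬M.
    go (just (~ex M nv)) eq =
      finish (∀-intro {M = ~ᵐ M} {nv = nv} (witness-∉ B) fresh {B = ⋁ (B ∷ Bs)} fresh-⋁ (collect eq))
        (weaken inj₂ (~∃-intro {M = M} {nv = nv} (witness-∉ B) (λ { _ refl → witness-∉ B })
          (unary (∀E {M = ~ᵐ M} {nv = nv} (witness B)) (λ _ s → s) (assumption refl))))

  module _ (A⊬ : ¬ initial true ⊢ E) where

    system : StagedConsequence (Sent S⁺)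
    system = record
      { _⊩_               = _⊩_
      ; ⊩-mono            = ⊩-mono
      ; ⊩-finite          = ⊩-finite
      ; _≺_               = _≺_
      ; ≺-wellFounded     = ≺-wellFounded
      ; ≺-trans           = λ {A} {B} {D} → ≺-trans {A} {B} {D}
      ; ≺-total           = ≺-total
      ; initial           = initial
      ; consistent        = λ { (proves [] _ d) → A⊬ d ; (proves (B ∷ _) p _) → case {B} (p B (here refl)) }
      ; added             = added
      ; Available         = Available
      ; initial-available = initial-available
      ; added-available   = added-available
      ; decide            = λ p q d e → cut-⊩ (decideˡ p q d) (decideʳ p q e)
      }
      where
      case : ∀ {B} → initial false B → Empty.⊥
      case ()

    open Lindenbaum em system

    -- The theory of accepted sentences: closure, primeness and witnesses.

    Theory : Pred (Sent S⁺) ℓ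
    Theory B = Lift ℓ (side B ≡ true)

    left : Theory ⊆ part true everything
    left {B} (lift eq) = inj₂ (B , _ , eq , inj₁ refl)

    right : ∀ {B} → ¬ Theory B → part false everything B
    right {B} ∉ with side B in eq
    ... | true  = contradiction (lift refl) ∉
    ... | false = inj₂ (B , _ , eq , inj₁ refl)

    -- Closure under provability, primeness and the failure of `E` are the cases of one, two and no
    -- disjuncts.
    unprovable : ¬ Theory ⊩ (λ B → ¬ Theory B)
    unprovable = part-consistent ∘ ⊩-mono left right

    Holds : Sent S⁺ → Set
    Holds B = side B ≡ true

    -- An instance placed along with its existential sentence still has a turn of its own. Rejected
    -- there, it would stand on both sides, against consistency.
    left-holds : ∀ {B} → B ∈ part true everything → Holds B
    left-holds {B} p with side B in eq
    ... | true  = refl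
    ... | false = contradiction
      (proves [ B ] (λ { _ (here refl) → inj₂ (B , _ , eq , inj₁ refl) })
        (∨-intro₁ {A = B} {B = E} (assumption p)))
      part-consistent

    initial-holds : ∀ {B} → B ∈ initial true → Holds B
    initial-holds = left-holds ∘ inj₁

    closed-holds : Theory ⊢ B → Holds B
    closed-holds {B = B} d with side B Bool.≟ true
    ... | yes p = p
    ... | no ¬p = contradiction
      (proves [ B ] (λ { _ (here refl) (lift p) → ¬p p }) (∨-intro₁ {A = B} {B = E} d)) unprovable

    by : ∀ {B} → Holds B → Theory ⊢ B
    by p = assumption (lift p)

    E-fails : ¬ Holds E
    E-fails p = unprovable (proves [] (λ _ ()) (by p))

    prime : ∀ {A B} → Theory ⊢ A ∨ˢ B → Holds A ⊎ Holds B
    prime {A} {B} d with side A Bool.≟ true | side B Bool.≟ true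
    ... | yes p | _     = inj₁ p
    ... | no _  | yes p = inj₂ p
    ... | no ¬p | no ¬q = contradiction
      (proves (A ∷ B ∷ []) (λ { _ (here refl) (lift p) → ¬p p ; _ (there (here refl)) (lift q) → ¬q q })
        (∨-elim {A = A} {B = B} d (⋁-intro {As = A ∷ B ∷ []} (here refl) new)
                                  (⋁-intro {As = A ∷ B ∷ []} (there (here refl)) new)))
      unprovable

    witnessed : ∀ {B} (e : Existential B) → existential? B ≡ just e →
                Holds B → Holds (instanceᵉ e (witness B))
    witnessed {B} e eq p = left-holds (inj₂ (B , _ , p , inj₂ (e , eq , refl)))

    -- Had `B` been rejected, its instance at the witness would have been placed on the right with
    -- it.
    universal-holds : ∀ {B} (u : Universal B) → universal? B ≡ just u →
                      Holds (instanceᵘ u (witness B)) → Holds B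
    universal-holds {B} u eq p with side B in eq′
    ... | true  = refl
    ... | false = contradiction
      (proves [ instanceᵘ u (witness B) ] (λ { _ (here refl) → inj₂ (B , _ , eq′ , inj₂ (u , eq , refl)) })
        (∨-intro₁ {A = instanceᵘ u (witness B)} {B = E} (assumption (left (lift p)))))
      part-consistent

    -- The canonical structure.

    infix 4 _~_
    _~_ : Const⁺ → Const⁺ → Set
    c ~ d = Holds (atomˢ {P = Letter S} (≈ S) (c ∷ d ∷ []))

    ~-replace : ∀ {x} (M : Matrix Const⁺ (Letter S) x) {c d} → c ~ d → Holds (M ⟨ c ⟩) → Holds (M ⟨ d ⟩)
    ~-replace M p q = closed-holds (≈-elim M (by p) (by q))

    ~-refl : ∀ {c} → c ~ c
    ~-refl {c} = closed-holds (≈I c given λ ())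

    ~-sym : ∀ {c d} → c ~ d → d ~ c
    ~-sym {c} {d} p = ~-replace M {c} {d} p ~-refl
      where
      M : Matrix Const⁺ (Letter S) 0
      M = matrix (atom (≈ S) (var 0 ∷ con c ∷ [])) λ { y (here (eq , _)) → eq ; y (there (here ())) }

    ~-trans : ∀ {c d e} → c ~ d → d ~ e → c ~ e
    ~-trans {c} {d} {e} p q = ~-replace M {d} {e} q p
      where
      M : Matrix Const⁺ (Letter S) 0
      M = matrix (atom (≈ S) (con c ∷ var 0 ∷ [])) λ { y (there (here (eq , _))) → eq }

    module ⊏ = IsStrictTotalOrder (proj₁ (proj₂ (wo Const⁺)))

    infix 4 _⊏_
    _⊏_ : Rel Const⁺ ℓ
    _⊏_ = proj₁ (wo Const⁺)

    -- Least members stand in for classes, so that identity of individuals is `≡` and no quotient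
    -- has to be formed.
    Least : Const⁺ → Const⁺ → Set ℓ
    Least c d = c ~ d × (∀ {e} → e ⊏ d → ¬ c ~ e)

    least : ∀ c → ∃ (Least c)
    least c = WF.All.wfRec (proj₂ (proj₂ (wo Const⁺))) _ (λ d → c ~ d → ∃ (Least c)) step c ~-refl
      where
      step : ∀ d → (∀ {e} → e ⊏ d → c ~ e → ∃ (Least c)) → c ~ d → ∃ (Least c)
      step d IH c~d with em {P = ∃ λ e → e ⊏ d × c ~ e}
      ... | yes (e , e⊏d , c~e) = IH e⊏d c~e
      ... | no ¬p               = d , c~d , λ e⊏d c~e → ¬p (_ , e⊏d , c~e)

    rep : Const⁺ → Const⁺
    rep = proj₁ ∘ least

    rep-~ : ∀ c → c ~ rep c
    rep-~ c = proj₁ (proj₂ (least c))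

    rep-cong : ∀ {c d} → c ~ d → rep c ≡ rep d
    rep-cong {c} {d} c~d with ⊏.compare (rep c) (rep d)
    ... | tri< lt _ _ = contradiction (~-trans {d} {c} {rep c} (~-sym {c} {d} c~d) (rep-~ c))
                                      (proj₂ (proj₂ (least d)) lt)
    ... | tri≈ _ eq _ = eq
    ... | tri> _ _ gt = contradiction (~-trans {c} {d} {rep d} c~d (rep-~ d)) (proj₂ (proj₂ (least c)) gt)

    -- Irrelevance of `canonical` makes individuals with equal names equal.
    record Individual : Set ℓ where
      constructor individual
      field
        name       : Const⁺
        .canonical : rep name ≡ name

    open Individual

    denote : Const⁺ → Individual
    denote c = individual (rep c) (rep-cong {rep c} {c} (~-sym {c} {rep c} (rep-~ c)))

    individual-≡ : ∀ {a b} → name a ≡ name b → a ≡ b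
    individual-≡ refl = refl

    -- The irrelevant equation is recovered by deciding it classically.
    rep-name : ∀ a → rep (name a) ≡ name a
    rep-name (individual c eq) = recompute em eq

    model : Structure S
    model = record
      { Dom      = Individual
      ; nonempty = denote (old (Injection.to (infinite S) 0))
      ; ⟦_⟧      = denote ∘ old
      ; pos      = λ R as → Lift ℓ (Holds (atomˢ R (Vec.map name as)))
      ; neg      = λ R as → Lift ℓ (Holds (~ˢ atomˢ R (Vec.map name as)))
      ; pos-≈    = λ a b → mk⇔
          (λ (lift p) → individual-≡
            (trans (sym (rep-name a)) (trans (rep-cong {name a} {name b} p) (rep-name b))))
          (λ { refl → lift ~-refl })
      }

    open Structure model using (Constᴰ; Sentᴰ; ⟦_⟧ᴰ; ⇑; IsValuation; Exhaustive; Exclusive)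

    -- Reads the diagram signature in the Henkin language, the name of an individual as its
    -- representative.
    constant : Constᴰ → Const⁺
    constant = [ old , name ]′

    constant-~ : ∀ c → constant c ~ name ⟦ c ⟧ᴰ
    constant-~ (inj₁ c) = rep-~ (old c)
    constant-~ (inj₂ a) = ~-refl

    val : Sentᴰ → Bool
    val B = side (mapˢ constant B)

    module _ {X : Set ℓ} {f g : X → Const⁺} (f~g : ∀ x → f x ~ g x) where

      -- `≈E` replaces one argument at a time; `F` is the atom, possibly negated, with the arguments
      -- already replaced filled in. `F-subst` and `F-free` confine its variables to the remaining
      -- arguments.
      replace-all : ∀ {n} (F : Vec (Term Const⁺) n → Formula Const⁺ (Letter S)) →
        (∀ c ts → subst (F ts) 0 (con c) ≡ F (Vec.map (substᵗ 0 (con c)) ts)) →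
        (F-free : ∀ {y} ts → y FreeIn F ts → Any (y FreeInᵗ_) ts) (xs : Vec X n) →
        Holds (sentence (F (Vec.map con (Vec.map f xs))) λ _ p → freeᵗ-con _ (F-free _ p)) →
        Holds (sentence (F (Vec.map con (Vec.map g xs))) λ _ p → freeᵗ-con _ (F-free _ p))
      replace-all F F-subst F-free []       p = p
      replace-all F F-subst F-free (x ∷ xs) p =
        replace-all (F ∘ (con (g x) ∷_)) (λ c ts → F-subst c (con (g x) ∷ ts))
          (λ ts q → tail (F-free (con (g x) ∷ ts) q)) xs
          (≡.subst Holds (sentence-≡ (at (g x)))
            (~-replace M {f x} {g x} (f~g x) (≡.subst Holds (sym (sentence-≡ (at (f x)))) p)))
        where
        cs = Vec.map f xs
        tail : ∀ {y c m} {ts : Vec (Term Const⁺) m} → Any (y FreeInᵗ_) (con c ∷ ts) → Any (y FreeInᵗ_) ts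
        tail (there q) = q
        only-0 : ∀ y → Any (y FreeInᵗ_) (var 0 ∷ Vec.map con cs) → y ≡ 0
        only-0 y (here (eq , _)) = eq
        only-0 y (there q)       = contradiction q (freeᵗ-con cs)
        M : Matrix Const⁺ (Letter S) 0
        M = matrix (F (var 0 ∷ Vec.map con cs)) λ y q → only-0 y (F-free _ q)
        constants-fixed : ∀ {m} c (ds : Vec Const⁺ m) →
                          Vec.map (substᵗ 0 (con c)) (Vec.map con ds) ≡ Vec.map con ds
        constants-fixed c []       = refl
        constants-fixed c (d ∷ ds) = cong (con d ∷_) (constants-fixed c ds)
        at : ∀ c → subst (F (var 0 ∷ Vec.map con cs)) 0 (con c) ≡ F (con c ∷ Vec.map con cs)
        at c = trans (F-subst c _) (cong (F ∘ (con c ∷_)) (constants-fixed c cs))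

      replace-atom : ∀ {n} (R : Letter S n) xs →
        Holds (atomˢ R (Vec.map f xs)) → Holds (atomˢ R (Vec.map g xs))
      replace-atom R = replace-all (atom R) (λ _ _ → refl) (λ _ p → p)

      replace-~atom : ∀ {n} (R : Letter S n) xs →
        Holds (~ˢ atomˢ R (Vec.map f xs)) → Holds (~ˢ atomˢ R (Vec.map g xs))
      replace-~atom R = replace-all (λ ts → ~ atom R ts) (λ _ _ → refl) (λ _ p → p)

    -- Each constant, a witness in particular, may be exchanged for the representative of its class;
    -- quantification over individuals therefore reaches all constants.
    every : ∀ {x} (M : Matrix Const⁺ (Letter S) x) → (∀ a → Holds (M ⟨ name a ⟩)) → ∀ c → Holds (M ⟨ c ⟩)
    every M p c = ~-replace M {rep c} {c} (~-sym {c} {rep c} (rep-~ c)) (p (denote c))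

    some : ∀ {x} (M : Matrix Const⁺ (Letter S) x) → ∃ (λ c → Holds (M ⟨ c ⟩)) →
           ∃ λ a → Holds (M ⟨ name a ⟩)
    some M (c , p) = denote c , ~-replace M {c} {rep c} (rep-~ c) p

    -- Truth clauses for the accepted sentences.

    module _ (A B : Sent S⁺) where

      holds-∧ : Holds (A ∧ˢ B) ⇔ (Holds A × Holds B)
      holds-∧ = mk⇔
        (λ p → closed-holds (unary (∧E₁ {B = B}) (λ _ q → q) (by p)) ,
               closed-holds {B = B} (unary (∧E₂ {A = A}) (λ _ q → q) (by p)))
        (λ (p , q) → closed-holds (∧-intro {A = A} {B = B} (by p) (by q)))

      holds-∨ : Holds (A ∨ˢ B) ⇔ (Holds A ⊎ Holds B)
      holds-∨ = mk⇔ (λ p → prime {A} {B} (by p))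
        [ (λ p → closed-holds (∨-intro₁ {A = A} {B = B} (by p)))
        , (λ p → closed-holds (∨-intro₂ {B = B} {A = A} (by p))) ]′

      holds-~∧ : Holds (~ˢ (A ∧ˢ B)) ⇔ (Holds (~ˢ A) ⊎ Holds (~ˢ B))
      holds-~∧ = mk⇔
        -- `~∧-elim` first yields the disjunction of the two negations, to which primeness applies.
        (λ p → prime {~ˢ A} {~ˢ B} (~∧-elim {A = A} {B = B} (by p)
          (∨-intro₁ {A = ~ˢ A} {B = ~ˢ B} new) (∨-intro₂ {B = ~ˢ B} {A = ~ˢ A} new)))
        [ (λ p → closed-holds (unary (~∧I₁ {A = A} {B = B}) (λ _ q → q) (by p)))
        , (λ p → closed-holds (unary (~∧I₂ {B = B} {A = A}) (λ _ q → q) (by p))) ]′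

      holds-~∨ : Holds (~ˢ (A ∨ˢ B)) ⇔ (Holds (~ˢ A) × Holds (~ˢ B))
      holds-~∨ = mk⇔
        (λ p → closed-holds (unary (~∨E₁ {A = A} {B = B}) (λ _ q → q) (by p)) ,
               closed-holds (unary (~∨E₂ {A = A} {B = B}) (λ _ q → q) (by p)))
        (λ (p , q) → closed-holds (~∨-intro {A = A} {B = B} (by p) (by q)))

    holds-~~ : ∀ A → Holds (~ˢ ~ˢ A) ⇔ Holds A
    holds-~~ A = mk⇔ (λ p → closed-holds (unary (~~E {A = A}) (λ _ q → q) (by p)))
                     (λ p → closed-holds (unary (~~I {A = A}) (λ _ q → q) (by p)))

    module _ {x : Var} (M : Matrix Const⁺ (Letter S) x) .(nv : x FreeIn body M) where

      holds-∀ : Holds (allˢ M nv) ⇔ (∀ a → Holds (M ⟨ name a ⟩))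
      holds-∀ = mk⇔
        (λ p a → closed-holds (unary (∀E {M = M} {nv = nv} (name a)) (λ _ q → q) (by p)))
        -- The constant left implicit is the witness of the universal sentence.
        (λ p → universal-holds (all M nv) refl (every M p _))

      holds-∃ : Holds (exˢ M nv) ⇔ (∃ λ a → Holds (M ⟨ name a ⟩))
      holds-∃ = mk⇔
        (λ p → some M (_ , witnessed (ex M nv) refl p))
        (λ (a , p) → closed-holds (unary (∃I {M = M} {nv = nv} (name a)) (λ _ q → q) (by p)))

      holds-~∀ : Holds (~ˢ allˢ M nv) ⇔ (∃ λ a → Holds (~ˢ (M ⟨ name a ⟩)))
      holds-~∀ = mk⇔
        (λ p → some (~ᵐ M) (_ , witnessed (~all M nv) refl p))
        (λ (a , p) → closed-holds (unary (~∀I {M = M} {nv = nv} (name a)) (λ _ q → q) (by p)))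

      holds-~∃ : Holds (~ˢ exˢ M nv) ⇔ (∀ a → Holds (~ˢ (M ⟨ name a ⟩)))
      holds-~∃ = mk⇔
        (λ p a → closed-holds (unary (~∃E {M = M} {nv = nv} (name a)) (λ _ q → q) (by p)))
        (λ p → universal-holds (~ex M nv) refl (every (~ᵐ M) p _))

    val-valuation : IsValuation val
    val-valuation = record
      { v-atom  = λ R cs → mk⇔
          (λ p → lift (≡.subst (λ ds → Holds (atomˢ R ds)) (Vec.map-∘ name ⟦_⟧ᴰ cs)
            (replace-atom constant-~ R cs (≡.subst Holds (mapˢ-atom constant R cs) p))))
          (λ (lift p) → ≡.subst Holds (sym (mapˢ-atom constant R cs))
            (replace-atom constant-~′ R cs
              (≡.subst (λ ds → Holds (atomˢ R ds)) (sym (Vec.map-∘ name ⟦_⟧ᴰ cs)) p)))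
      ; v-~atom = λ R cs → mk⇔
          (λ p → lift (≡.subst (λ ds → Holds (~ˢ atomˢ R ds)) (Vec.map-∘ name ⟦_⟧ᴰ cs)
            (replace-~atom constant-~ R cs (≡.subst Holds (cong ~ˢ_ (mapˢ-atom constant R cs)) p))))
          (λ (lift p) → ≡.subst Holds (sym (cong ~ˢ_ (mapˢ-atom constant R cs)))
            (replace-~atom constant-~′ R cs
              (≡.subst (λ ds → Holds (~ˢ atomˢ R ds)) (sym (Vec.map-∘ name ⟦_⟧ᴰ cs)) p)))
      ; v-∧     = λ A B → holds-∧ (mapˢ constant A) (mapˢ constant B)
      ; v-∨     = λ A B → holds-∨ (mapˢ constant A) (mapˢ constant B)
      ; v-~∧    = λ A B → holds-~∧ (mapˢ constant A) (mapˢ constant B)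
      ; v-~∨    = λ A B → holds-~∨ (mapˢ constant A) (mapˢ constant B)
      ; v-~~    = λ A → holds-~~ (mapˢ constant A)
      ; v-∀     = λ M nv → ⇔.trans (holds-∀ (mapᵐ constant M) (free-map (body M) nv)) (∀-instances M)
      ; v-∃     = λ M nv → ⇔.trans (holds-∃ (mapᵐ constant M) (free-map (body M) nv)) (∃-instances M)
      ; v-~∀    = λ M nv → ⇔.trans (holds-~∀ (mapᵐ constant M) (free-map (body M) nv)) (∃-instances (~ᵐ M))
      ; v-~∃    = λ M nv → ⇔.trans (holds-~∃ (mapᵐ constant M) (free-map (body M) nv)) (∀-instances (~ᵐ M))
      }
      where
      constant-~′ : ∀ c → name ⟦ c ⟧ᴰ ~ constant c
      constant-~′ c = ~-sym {constant c} {name ⟦ c ⟧ᴰ} (constant-~ c)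

      module _ {x : Var} (M : Matrix Constᴰ (Letter S) x) where

        ∀-instances : (∀ a → Holds (mapᵐ constant M ⟨ name a ⟩)) ⇔
                      (∀ a → Holds (mapˢ constant (M ⟨ inj₂ a ⟩)))
        ∀-instances = mk⇔ (λ p a → ≡.subst Holds (sym (mapˢ-⟨⟩ constant M (inj₂ a))) (p a))
                          (λ p a → ≡.subst Holds (mapˢ-⟨⟩ constant M (inj₂ a)) (p a))

        ∃-instances : ∃ (λ a → Holds (mapᵐ constant M ⟨ name a ⟩)) ⇔
                      ∃ (λ a → Holds (mapˢ constant (M ⟨ inj₂ a ⟩)))
        ∃-instances = mk⇔ (λ (a , p) → a , ≡.subst Holds (sym (mapˢ-⟨⟩ constant M (inj₂ a))) p)
                          (λ (a , p) → a , ≡.subst Holds (mapˢ-⟨⟩ constant M (inj₂ a)) p)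

    -- Completeness, and the theorem.

    val-⇑ : ∀ A → val (⇑ A) ≡ side (mapˢ old A)
    val-⇑ A = cong side (sentence-≡ (map-∘ (formula A)))

    model-exhaustive : HasPEM L → Exhaustive
    model-exhaustive pem R as = Sum.map lift lift (prime (PEM pem (atomˢ R (Vec.map name as)) given λ ()))

    model-exclusive : HasEXP L → Exclusive
    model-exclusive exp R as (lift p , lift q) =
      E-fails (closed-holds (explosion {A = atomˢ R (Vec.map name as)} exp (by p) (by q)))

    countermodel : IsStructureFor L model → ¬ [ L ∣ S ] Γ₀ ⊨ A₀
    countermodel ok Γ⊨A = E-fails (trans (sym (val-⇑ A₀)) (Γ⊨A model ok val val-valuation
      λ B B∈Γ → trans (val-⇑ B) (initial-holds (B , B∈Γ , refl))))

  initial-provable : [ L ∣ S ] Γ₀ ⊨ A₀ → initial true ⊢ E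
  initial-provable Γ⊨A with em {P = initial true ⊢ E}
  ... | yes d  = d
  ... | no A⊬ = contradiction Γ⊨A (countermodel A⊬ (structure L refl))
    where
    -- `L` is a parameter fixed outside, so the cases are distinguished on a copy of it.
    structure : ∀ L′ → L ≡ L′ → IsStructureFor L′ (model A⊬)
    structure QLP refl = model-exhaustive A⊬ QLP
    structure QK3 refl = model-exclusive A⊬ QK3
    structure QCL refl = model-exhaustive A⊬ QCL , model-exclusive A⊬ QCL

  complete : [ L ∣ S ] Γ₀ ⊨ A₀ → [ L ∣ S ] Γ₀ ⊢ A₀
  complete Γ⊨A with initial-provable Γ⊨A
  ... | d given p = derivation d′ , hypotheses d′
    where
    open Renaming em L S (henkin-infinite {P = Letter S} (infinite S))
    open Provability L S using () renaming (_⊢_ to _⊢₀_; weaken to weaken₀; transport to transport₀)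
    open Provability._⊢_

    restore : Const⁺ → Const S
    restore (old c) = c
    -- All witnesses may go to a single old constant, since `rename` admits maps that are not
    -- injective.
    restore (wit _) = Injection.to (infinite S) 0

    restore-old : ∀ A → mapˢ restore (mapˢ old A) ≡ A
    restore-old A = sentence-≡ (trans (map-∘ (formula A)) (map-id (formula A)))

    restored : image restore (Hyp L S⁺ d) ⊆ Γ₀
    restored (X , X∈d , refl) with p X∈d
    ... | B , B∈Γ , refl = ≡.subst Γ₀ (sym (restore-old B)) B∈Γ

    d′ : Γ₀ ⊢₀ A₀
    d′ = transport₀ (restore-old A₀) (weaken₀ restored (rename d restore))

theorem31 : {ℓ : Level} → ExcludedMiddle ℓ → WellOrdering ℓ →
            (L : Logic) (S : Signature ℓ) (Γ : Pred (Sent S) ℓ) (A : Sent S) →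
            ([ L ∣ S ] Γ ⊢ A) ⇔ ([ L ∣ S ] Γ ⊨ A)
theorem31 em wo L S Γ A = mk⇔ sound′ (HenkinTheory.complete em wo L S Γ A)
  where
  sound′ : [ L ∣ S ] Γ ⊢ A → [ L ∣ S ] Γ ⊨ A
  -- Under the assignment `inj₁`, the sentences evaluated are exactly those given by `⇑`.
  sound′ (d , p) 𝔄 isL v val sat = Valuation.sound em 𝔄 v val L isL d inj₁ λ X X∈d → sat X (p X∈d)
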